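{- For every integer $h\ge0$ and every real $r>0$, $$P_h(X,r)=\det\bigl(I-\sqrt X\,A_h(r)\bigr),$$ where $I$ is the identity matrix of the appropriate size, the determinant of a $0\times0$ matrix is one, and the right-hand side is understood as the resulting polynomial in $X$ (independent of the choice of square-root branch). For $h\ge2$, the zeros of $P_h(X,r)$ in $X$ are positive real numbers, and the smallest positive zero is $\Lambda_h(r)^{ -1}$.
   Context: For $h\ge0$, $P_h(X,Q)=\sum_{m=0}^{\lfloor h/2\rfloor}(-X)^mQ^{m(m-1)}\begin{bmatrix} h-m \\ m \end{bmatrix}_Q$, where $\begin{bmatrix} N \\ m \end{bmatrix}_Q$ is the Gaussian binomial polynomial in $Q$ (so $P_0=P_1=1$). For $r>0$, $A_0(r)$ is the empty matrix, $A_1(r)$ is the $1\times1$ zero matrix, and for $h\ge2$, $A_h(r)$ is the $h\times h$ real symmetric tridiagonal matrix with zero diagonal and $(A_h(r))_{i,i+1}=(A_h(r))_{i+1,i}=r^{(i-1)/2}$ for $1\le i\le h-1$. For $h\ge1$, $\lambda_h(r)$ is the spectral radius of $A_h(r)$ and $\Lambda_h(r)=\lambda_h(r)^2$. -}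

module Defs where

open import Level using (Level; _⊔_) renaming (suc to lsuc)
open import Algebra.Bundles using (CommutativeRing)
open import Algebra.Bundles.Raw using (RawRing)
import Algebra.Definitions
import Algebra.Definitions.RawMonoid
import Algebra.Definitions.RawSemiring
import Algebra.Properties.Ring
import Algebra.Solver.Ring.NaturalCoefficients.Default as Solver
open import Data.Empty using (⊥-elim)
open import Data.Fin using (Fin; zero; suc; toℕ; punchIn)
import Data.Fin as Fin
open import Data.List using (List; []; _∷_; map; foldr)
open import Data.Nat as ℕ using (ℕ; zero; suc; _∸_; ⌊_/2⌋)
import Data.Nat.Properties as ℕₚ
open import Data.Product using (∃; Σ; _×_; _,_; proj₁; proj₂)
open import Data.Sum using (inj₁; inj₂)
open import Relation.Binary.Core using (Rel)
open import Relation.Binary.Definitions using (Tri; tri<; tri≈; tri>)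
open import Relation.Binary.Structures using (IsStrictTotalOrder)
import Relation.Binary.Construct.StrictToNonStrict as ToNonStrict
import Relation.Binary.PropositionalEquality as ≡
open import Relation.Nullary using (¬_; yes; no)
open import Relation.Unary using (Pred; Satisfiable)

private
  variable
    c ℓ c′ ℓ′ : Level

module Matrices (R : RawRing c ℓ) where
  open RawRing R
  open Algebra.Definitions.RawMonoid +-rawMonoid using (sum)
  open Algebra.Definitions.RawSemiring rawSemiring using (_^_)

  Matrix : ℕ → Set c
  Matrix n = Fin n → Fin n → Carrier

  -- Laplace expansion along the first row.
  det : ∀ {n} → Matrix n → Carrier
  det {zero}  M = 1#
  det {suc n} M = sum λ j →
    (- 1#) ^ toℕ j * (M zero j * det λ i k → M (suc i) (punchIn j k))

  1ₘ : ∀ {n} → Matrix n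
  1ₘ i j with i Fin.≟ j
  ... | yes _ = 1#
  ... | no  _ = 0#

  infixl 6 _-ₘ_
  _-ₘ_ : ∀ {n} → Matrix n → Matrix n → Matrix n
  (M -ₘ N) i j = M i j + - N i j

  infixr 7 _·ₘ_
  _·ₘ_ : ∀ {n} → Carrier → Matrix n → Matrix n
  (a ·ₘ M) i j = a * M i j

  IsEigenvalue : ∀ {n} → Matrix n → Carrier → Set (c ⊔ ℓ)
  IsEigenvalue {n} M μ = Σ (Fin n → Carrier) λ v →
    ¬ (∀ i → v i ≈ 0#) × (∀ i → sum (λ j → M i j * v j) ≈ μ * v i)

mapₘ : {A : Set c} {B : Set c′} {n : ℕ} →
       (A → B) → (Fin n → Fin n → A) → (Fin n → Fin n → B)
mapₘ f M i j = f (M i j)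

-- Univariate polynomials: lists of coefficients, constant term first,
-- identified when all coefficients agree (so trailing zeros are
-- immaterial).
module Polynomials (R : RawRing c ℓ) where
  open RawRing R

  Poly : Set c
  Poly = List Carrier

  coeff : Poly → ℕ → Carrier
  coeff []      _       = 0#
  coeff (a ∷ p) zero    = a
  coeff (a ∷ p) (suc k) = coeff p k

  infix 4 _≈ₚ_
  _≈ₚ_ : Poly → Poly → Set ℓ
  p ≈ₚ q = ∀ k → coeff p k ≈ coeff q k

  infixl 6 _+ₚ_
  _+ₚ_ : Poly → Poly → Poly
  []      +ₚ q       = q
  (a ∷ p) +ₚ []      = a ∷ p
  (a ∷ p) +ₚ (b ∷ q) = (a + b) ∷ (p +ₚ q)

  infixl 7 _*ₚ_
  _*ₚ_ : Poly → Poly → Poly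
  []      *ₚ q = []
  (a ∷ p) *ₚ q = map (a *_) q +ₚ (0# ∷ (p *ₚ q))

  polyRing : RawRing c ℓ
  polyRing = record
    { Carrier = Poly
    ; _≈_     = _≈ₚ_
    ; _+_     = _+ₚ_
    ; _*_     = _*ₚ_
    ; -_      = map (-_)
    ; 0#      = []
    ; 1#      = 1# ∷ []
    }

  const : Carrier → Poly
  const a = a ∷ []

  indet : Poly
  indet = 0# ∷ 1# ∷ []

  -- Value at x ∈ B of a polynomial whose coefficients are sent to B by
  -- ι; with B = polyRing and ι = const this is substitution.
  eval : (B : RawRing c′ ℓ′) → (Carrier → RawRing.Carrier B) →
         RawRing.Carrier B → Poly → RawRing.Carrier B
  eval B ι x = foldr (λ a y → ι a B.+ x B.* y) B.0#
    where module B = RawRing B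

module _ (R : RawRing c ℓ) where
  open RawRing R
  open Algebra.Definitions.RawSemiring rawSemiring using (_^_)

  -- The Gaussian binomial polynomial at Q = q, by the q-Pascal rule
  -- (which, unlike the quotient of q-factorials, makes sense for all q).
  -- See gauss-factorial below for the quotient formula.
  gauss : Carrier → ℕ → ℕ → Carrier
  gauss q n       zero    = 1#
  gauss q zero    (suc m) = 0#
  gauss q (suc n) (suc m) = gauss q n m + q ^ suc m * gauss q n (suc m)

  open Polynomials R
  private
    module P  = RawRing polyRing
    module P^ = Algebra.Definitions.RawSemiring P.rawSemiring
  open Algebra.Definitions.RawMonoid P.+-rawMonoid using (sum)

  -- P_h(X, q) as a polynomial in X over R.
  pathPoly : Carrier → ℕ → Poly
  pathPoly q h = sum {suc ⌊ h /2⌋} λ i → let m = toℕ i in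
    ((P.- indet) P^.^ m) P.*
    const (q ^ (m ℕ.* (m ∸ 1)) * gauss q (h ∸ m) m)

module _ (R : CommutativeRing c ℓ) where
  open CommutativeRing R
  open Algebra.Definitions.RawSemiring (RawRing.rawSemiring rawRing) using (_^_)
  open Solver commutativeSemiring

  qint : Carrier → ℕ → Carrier
  qint q zero    = 0#
  qint q (suc n) = 1# + q * qint q n

  qfact : Carrier → ℕ → Carrier
  qfact q zero    = 1#
  qfact q (suc n) = qint q (suc n) * qfact q n

  private
    qint-+ : ∀ q m n → qint q m + q ^ m * qint q n ≈ qint q (m ℕ.+ n)
    qint-+ q zero    n = trans (+-identityˡ _) (*-identityˡ _)
    qint-+ q (suc m) n = trans
      (regroup q (qint q m) (q ^ m) (qint q n))
      (+-congˡ (*-congˡ (qint-+ q m n)))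
      where
      regroup : ∀ q a b d → (1# + q * a) + (q * b) * d ≈ 1# + q * (a + b * d)
      regroup = solve 4 (λ q a b d →
        (con 1 :+ q :* a) :+ (q :* b) :* d := con 1 :+ q :* (a :+ b :* d)) refl

    gauss-> : ∀ q n k → gauss rawRing q n (n ℕ.+ suc k) ≈ 0#
    gauss-> q zero    k = refl
    gauss-> q (suc n) k = trans (+-cong (gauss-> q n k) (*-congˡ
      (trans (reflexive (≡.cong (gauss rawRing q n) (≡.sym (ℕₚ.+-suc n (suc k)))))
             (gauss-> q n (suc k)))))
      (trans (+-identityˡ _) (zeroʳ _))

    gauss-diag : ∀ q n → gauss rawRing q n n ≈ 1#
    gauss-diag q zero    = refl
    gauss-diag q (suc n) = trans (+-cong (gauss-diag q n) (*-congˡ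
      (trans (reflexive (≡.cong (gauss rawRing q n) (ℕₚ.+-comm 1 n))) (gauss-> q n 0))))
      (trans (+-congˡ (zeroʳ _)) (+-identityʳ _))

  gauss-factorial : ∀ q m k →
    gauss rawRing q (m ℕ.+ k) m * (qfact q m * qfact q k) ≈ qfact q (m ℕ.+ k)
  gauss-factorial q zero    k = trans (*-identityˡ _) (*-identityˡ _)
  gauss-factorial q (suc m) zero = trans
    (*-cong (trans (reflexive (≡.cong (λ n → gauss rawRing q n (suc m)) (ℕₚ.+-identityʳ (suc m))))
                   (gauss-diag q (suc m)))
            (*-identityʳ _))
    (trans (*-identityˡ _)
           (reflexive (≡.cong (qfact q) (≡.sym (ℕₚ.+-identityʳ (suc m))))))
  gauss-factorial q (suc m) (suc k) = trans
    (regroup (gauss rawRing q (m ℕ.+ suc k) m) (q ^ suc m)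
             (gauss rawRing q (m ℕ.+ suc k) (suc m))
             (qint q (suc m)) (qfact q m) (qint q (suc k)) (qfact q k))
    (trans (+-cong (*-congˡ (gauss-factorial q m (suc k)))
                   (*-congˡ (*-congʳ (reflexive (≡.cong (λ n → gauss rawRing q n (suc m)) (ℕₚ.+-suc m k))))))
    (trans (+-congˡ (*-congˡ (trans (gauss-factorial q (suc m) k)
             (reflexive (≡.cong (qfact q) (≡.sym (ℕₚ.+-suc m k)))))))
    (trans (sym (distribʳ _ _ _)) (*-congʳ (qint-+ q (suc m) (suc k))))))
    where
    regroup : ∀ g e g′ a f b f′ →
      (g + e * g′) * ((a * f) * (b * f′)) ≈
      a * (g * (f * (b * f′))) + (e * b) * (g′ * ((a * f) * f′))
    regroup = solve 7 (λ g e g′ a f b f′ →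
      (g :+ e :* g′) :* ((a :* f) :* (b :* f′)) :=
      a :* (g :* (f :* (b :* f′))) :+ (e :* b) :* (g′ :* ((a :* f) :* f′))) refl

-- The real numbers, axiomatised (up to isomorphism, classically) as a
-- Dedekind-complete totally ordered field.
record RealNumbers (ℓ : Level) : Set (lsuc ℓ) where
  infix 4 _<_
  field
    commutativeRing : CommutativeRing ℓ ℓ

  open CommutativeRing commutativeRing public

  field
    _<_                : Rel Carrier ℓ
    isStrictTotalOrder : IsStrictTotalOrder _≈_ _<_
    0<1                : 0# < 1#
    +-monoˡ-<          : ∀ z {x y} → x < y → x + z < y + z
    *-pos              : ∀ {x y} → 0# < x → 0# < y → 0# < x * y
    invertible         : ∀ {x} → x ≉ 0# → Algebra.Definitions.Invertible _≈_ 1# _*_ x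

  open ToNonStrict _≈_ _<_ public using (_≤_)

  UpperBound : Pred Carrier ℓ → Pred Carrier ℓ
  UpperBound S b = ∀ {x} → S x → x ≤ b

  field
    supremum : (S : Pred Carrier ℓ) → Satisfiable S → Satisfiable (UpperBound S) →
               ∃ λ s → UpperBound S s × (∀ {b} → UpperBound S b → s ≤ b)

module Reals {ℓ : Level} (𝓡 : RealNumbers ℓ) where
  open RealNumbers 𝓡 public hiding (Carrier)
  open RealNumbers 𝓡 using () renaming (Carrier to ℝ) public
  open IsStrictTotalOrder isStrictTotalOrder public
    using (compare; <-respʳ-≈; <-respˡ-≈)
    renaming (trans to <-trans; irrefl to <-irrefl; asym to <-asym)
  open Algebra.Definitions.RawSemiring (RawRing.rawSemiring rawRing) public using (_^_)

  inverse : ∀ {x} → x ≉ 0# → ℝ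
  inverse x≉0 = proj₁ (invertible x≉0)

  module OrderedField where
    private open module S = Solver commutativeSemiring using (solve; _:=_; _:+_; _:*_; con)
    open Algebra.Properties.Ring ring using (-‿distribˡ-*; -‿distribʳ-*; -‿involutive)

    resp : ∀ {a b a′ b′} → a ≈ a′ → b ≈ b′ → a < b → a′ < b′
    resp p q a<b = <-respˡ-≈ p (<-respʳ-≈ q a<b)

    <⇒≱ : ∀ {a b} → a < b → ¬ (b ≤ a)
    <⇒≱ a<b (inj₁ b<a) = <-asym a<b b<a
    <⇒≱ a<b (inj₂ b≈a) = <-irrefl (sym b≈a) a<b

    <-≤-trans : ∀ {a b d} → a < b → b ≤ d → a < d
    <-≤-trans = ToNonStrict.<-≤-trans _≈_ _<_ <-trans <-respʳ-≈

    ≤-<-trans : ∀ {a b d} → a ≤ b → b < d → a < d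
    ≤-<-trans (inj₁ a<b) b<d = <-trans a<b b<d
    ≤-<-trans (inj₂ a≈b) b<d = <-respˡ-≈ (sym a≈b) b<d

    <0⇒0<- : ∀ {a} → a < 0# → 0# < - a
    <0⇒0<- {a} a<0 = resp (-‿inverseʳ a) (+-identityˡ _) (+-monoˡ-< (- a) a<0)

    +-cancel-< : ∀ d {a b} → a + d < b + d → a < b
    +-cancel-< d {a} {b} p = resp (lem a) (lem b) (+-monoˡ-< (- d) p)
      where
      lem : ∀ x → (x + d) + - d ≈ x
      lem x = trans (+-assoc _ _ _) (trans (+-congˡ (-‿inverseʳ d)) (+-identityʳ x))

    *-monoˡ : ∀ {a b d} → 0# < d → a < b → a * d < b * d
    *-monoˡ {a} {b} {d} 0<d a<b =
      resp (+-identityˡ _)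
           (trans (sym (distribʳ d _ _))
                  (*-congʳ (trans (+-assoc _ _ _) (trans (+-congˡ (-‿inverseˡ a)) (+-identityʳ b)))))
           (+-monoˡ-< (a * d) (*-pos (resp (-‿inverseʳ a) refl (+-monoˡ-< (- a) a<b)) 0<d))

    *-cancel-< : ∀ {a b d} → 0# < d → a * d < b * d → a < b
    *-cancel-< {a} {b} 0<d p with compare a b
    ... | tri< a<b _ _ = a<b
    ... | tri≈ _ a≈b _ = ⊥-elim (<-irrefl (*-congʳ a≈b) p)
    ... | tri> _ _ b<a = ⊥-elim (<-asym p (*-monoˡ 0<d b<a))

    sq-mono : ∀ {a b} → 0# ≤ a → a < b → a * a < b * b
    sq-mono {a} {b} (inj₁ 0<a) a<b = <-trans (*-monoˡ 0<a a<b)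
      (<-respˡ-≈ (*-comm a b) (*-monoˡ (<-trans 0<a a<b) a<b))
    sq-mono {a} {b} (inj₂ 0≈a) a<b =
      <-respˡ-≈ (sym (trans (*-congʳ (sym 0≈a)) (zeroˡ a)))
        (*-pos (<-respˡ-≈ (sym 0≈a) a<b) (<-respˡ-≈ (sym 0≈a) a<b))

    sq-cancel : ∀ {a b} → 0# ≤ b → a * a < b * b → a < b
    sq-cancel {a} {b} 0≤b p with compare a b
    ... | tri< a<b _ _ = a<b
    ... | tri≈ _ a≈b _ = ⊥-elim (<-irrefl (*-cong a≈b a≈b) p)
    ... | tri> _ _ b<a = ⊥-elim (<-asym p (sq-mono 0≤b b<a))

    inverse-pos : ∀ {a b} → 0# < a → b * a ≈ 1# → 0# < b
    inverse-pos 0<a e = *-cancel-< 0<a (resp (sym (zeroˡ _)) (sym e) 0<1)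

    exchange : ∀ {a b d e} → a + b ≈ d + e → d < b → a < e
    exchange {b = b} {e = e} p d<b =
      +-cancel-< b (resp (sym p) (+-comm b e) (+-monoˡ-< e d<b))

    exchange′ : ∀ {a b d e} → a + b ≈ d + e → b < d → e < a
    exchange′ p b<d = exchange (trans (+-comm _ _) (trans (sym p) (+-comm _ _))) b<d

    0≤+0< : ∀ {a b} → 0# ≤ a → 0# < b → 0# < a + b
    0≤+0< {a} {b} 0≤a 0<b =
      ≤-<-trans 0≤a (resp (+-identityˡ a) (+-comm b a) (+-monoˡ-< a 0<b))

    0≤*0≤ : ∀ {a b} → 0# ≤ a → 0# ≤ b → 0# ≤ a * b
    0≤*0≤ (inj₁ 0<a) (inj₁ 0<b) = inj₁ (*-pos 0<a 0<b)
    0≤*0≤ (inj₁ 0<a) (inj₂ 0≈b) = inj₂ (sym (trans (*-congˡ (sym 0≈b)) (zeroʳ _)))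
    0≤*0≤ (inj₂ 0≈a) _          = inj₂ (sym (trans (*-congʳ (sym 0≈a)) (zeroˡ _)))

    0≤+0≤ : ∀ {a b} → 0# ≤ a → 0# ≤ b → 0# ≤ a + b
    0≤+0≤ 0≤a (inj₁ 0<b) = inj₁ (0≤+0< 0≤a 0<b)
    0≤+0≤ (inj₁ 0<a) (inj₂ 0≈b) = inj₁ (<-respʳ-≈ (trans (sym (+-identityʳ _)) (+-congˡ 0≈b)) 0<a)
    0≤+0≤ (inj₂ 0≈a) (inj₂ 0≈b) = inj₂ (trans (sym (+-identityʳ _)) (+-cong 0≈a 0≈b))

    0≤a² : ∀ a → 0# ≤ a * a
    0≤a² a with compare 0# a
    ... | tri< 0<a _ _ = inj₁ (*-pos 0<a 0<a)
    ... | tri≈ _ 0≈a _ = inj₂ (sym (trans (*-congʳ (sym 0≈a)) (zeroˡ a)))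
    ... | tri> _ _ a<0 = inj₁ (<-respʳ-≈ neg² (*-pos (<0⇒0<- a<0) (<0⇒0<- a<0)))
      where
      neg² : - a * - a ≈ a * a
      neg² = trans (sym (-‿distribˡ-* a (- a)))
                   (trans (-‿cong (sym (-‿distribʳ-* a a))) (-‿involutive _))

    sqrt-exists : ∀ {x} → 0# ≤ x → ∃ λ y → 0# ≤ y × y * y ≈ x
    sqrt-exists {x} 0≤x = s , 0≤s , s²≈x
      where
      S : Pred ℝ ℓ
      S y = 0# ≤ y × y * y ≤ x

      k = x + 1#
      m = x * x + (x + 1#)

      0<k : 0# < k
      0<k = 0≤+0< 0≤x 0<1

      0<m : 0# < m
      0<m = 0≤+0< (0≤a² x) 0<k

      k² : x < k * k
      k² = resp (+-identityˡ x) (id₁ x) (+-monoˡ-< x 0<m)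
        where
        id₁ : ∀ x → (x * x + (x + 1#)) + x ≈ (x + 1#) * (x + 1#)
        id₁ = solve 1 (λ x → (x :* x :+ (x :+ con 1)) :+ x :=
                             (x :+ con 1) :* (x :+ con 1)) refl

      bounded : UpperBound S k
      bounded (_ , y²≤x) = inj₁ (sq-cancel (inj₁ 0<k) (≤-<-trans y²≤x k²))

      0∈S : S 0#
      0∈S = inj₂ refl , ≤x 0≤x
        where
        ≤x : 0# ≤ x → 0# * 0# ≤ x
        ≤x (inj₁ p) = inj₁ (<-respˡ-≈ (sym (zeroˡ _)) p)
        ≤x (inj₂ p) = inj₂ (trans (zeroˡ _) p)

      sup = supremum S (0# , 0∈S) (k , bounded)
      s   = proj₁ sup

      0≤s : 0# ≤ s
      0≤s = proj₁ (proj₂ sup) 0∈S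

      D = s + k

      0<D : 0# < D
      0<D = 0≤+0< 0≤s 0<k

      D≉0 : D ≉ 0#
      D≉0 D≈0 = <-irrefl (sym D≈0) 0<D

      D⁻¹ = inverse D≉0

      D⁻¹D : D⁻¹ * D ≈ 1#
      D⁻¹D = proj₁ (proj₂ (invertible D≉0))

      n = k * s + x
      t = n * D⁻¹

      tD : t * D ≈ n
      tD = trans (*-assoc _ _ _) (trans (*-congˡ D⁻¹D) (*-identityʳ n))

      0≤t : 0# ≤ t
      0≤t = 0≤*0≤ (0≤+0≤ (0≤*0≤ (inj₁ 0<k) 0≤s) 0≤x) (inj₁ (inverse-pos 0<D (trans (*-comm _ _) (proj₂ (proj₂ (invertible D≉0))))))

      sD : s * D ≈ s * s + k * s
      sD = id₂ s k
        where
        id₂ : ∀ s k → s * (s + k) ≈ s * s + k * s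
        id₂ = solve 2 (λ s k → s :* (s :+ k) := s :* s :+ k :* s) refl

      t²D² : (t * t) * (D * D) ≈ n * n
      t²D² = trans (id₃ t D) (*-cong tD tD)
        where
        id₃ : ∀ t d → (t * t) * (d * d) ≈ (t * d) * (t * d)
        id₃ = solve 2 (λ t d → (t :* t) :* (d :* d) := (t :* d) :* (t :* d)) refl

      key : n * n + x * m ≈ (s * s) * m + x * (D * D)
      key = id₄ s x
        where
        id₄ : ∀ s x →
          ((x + 1#) * s + x) * ((x + 1#) * s + x) + x * (x * x + (x + 1#)) ≈
          (s * s) * (x * x + (x + 1#)) + x * ((s + (x + 1#)) * (s + (x + 1#)))
        id₄ = solve 2 (λ s x →
          ((x :+ con 1) :* s :+ x) :* ((x :+ con 1) :* s :+ x) :+ x :* (x :* x :+ (x :+ con 1)) :=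
          (s :* s) :* (x :* x :+ (x :+ con 1)) :+ x :* ((s :+ (x :+ con 1)) :* (s :+ (x :+ con 1)))) refl

      s²≈x : s * s ≈ x
      s²≈x with compare (s * s) x
      ... | tri≈ _ p _ = p
      ... | tri< s²<x _ _ = ⊥-elim (<⇒≱ s<t (proj₁ (proj₂ sup) (0≤t , inj₁ t²<x)))
        where
        s<t : s < t
        s<t = *-cancel-< 0<D (resp (sym sD) (trans (+-comm _ _) (sym tD)) (+-monoˡ-< (k * s) s²<x))
        t²<x : t * t < x
        t²<x = *-cancel-< (*-pos 0<D 0<D)
          (<-respˡ-≈ (sym t²D²) (exchange key (*-monoˡ 0<m s²<x)))
      ... | tri> _ _ x<s² = ⊥-elim (<⇒≱ t<s (proj₂ (proj₂ sup) t-bound))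
        where
        t<s : t < s
        t<s = *-cancel-< 0<D (resp (trans (+-comm _ _) (sym tD)) (sym sD) (+-monoˡ-< (k * s) x<s²))
        x<t² : x < t * t
        x<t² = *-cancel-< (*-pos 0<D 0<D)
          (<-respʳ-≈ (sym t²D²) (exchange′ key (*-monoˡ 0<m x<s²)))
        t-bound : UpperBound S t
        t-bound (_ , y²≤x) = inj₁ (sq-cancel 0≤t (≤-<-trans y²≤x x<t²))

  open OrderedField using (sqrt-exists; 0≤+0≤; 0≤a²)

  √ : ∀ {x} → 0# ≤ x → ℝ
  √ 0≤x = proj₁ (sqrt-exists 0≤x)

  √-nonneg : ∀ {x} (0≤x : 0# ≤ x) → 0# ≤ √ 0≤x
  √-nonneg 0≤x = proj₁ (proj₂ (sqrt-exists 0≤x))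

  √-square : ∀ {x} (0≤x : 0# ≤ x) → √ 0≤x * √ 0≤x ≈ x
  √-square 0≤x = proj₂ (proj₂ (sqrt-exists 0≤x))

  ℂ : Set ℓ
  ℂ = ℝ × ℝ

  Re Im : ℂ → ℝ
  Re = proj₁
  Im = proj₂

  complexRing : RawRing ℓ ℓ
  complexRing = record
    { Carrier = ℂ
    ; _≈_     = λ { (a , b) (a′ , b′) → a ≈ a′ × b ≈ b′ }
    ; _+_     = λ { (a , b) (a′ , b′) → a + a′ , b + b′ }
    ; _*_     = λ { (a , b) (a′ , b′) → a * a′ - b * b′ , a * b′ + b * a′ }
    ; -_      = λ { (a , b) → - a , - b }
    ; 0#      = 0# , 0#
    ; 1#      = 1# , 0#
    }

  open RawRing complexRing public using () renaming (_≈_ to _≈ᶜ_; 0# to 0ᶜ)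

  ofReal : ℝ → ℂ
  ofReal a = a , 0#

  ∣_∣ᶜ : ℂ → ℝ
  ∣ z ∣ᶜ = √ (0≤+0≤ (0≤a² (Re z)) (0≤a² (Im z)))

  open Matrices rawRing public using (Matrix)
  open Polynomials rawRing public using (Poly; polyRing; indet; const; eval; _≈ₚ_)

  -- A relation, since a maximal |eigenvalue| has to be shown to exist;
  -- it determines ρ up to ≈.
  IsSpectralRadius : ∀ {n} → Matrix n → ℝ → Set ℓ
  IsSpectralRadius M ρ =
    (∃ λ μ → IsEigenvalueᶜ μ × ρ ≈ ∣ μ ∣ᶜ) ×
    (∀ μ → IsEigenvalueᶜ μ → ∣ μ ∣ᶜ ≤ ρ)
    where
    IsEigenvalueᶜ : ℂ → Set ℓ
    IsEigenvalueᶜ = Matrices.IsEigenvalue complexRing (mapₘ ofReal M)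

  IsComplexZero : Poly → ℂ → Set ℓ
  IsComplexZero p z = eval complexRing ofReal z p ≈ᶜ 0ᶜ

  IsSmallestPositiveZero : Poly → ℝ → Set ℓ
  IsSmallestPositiveZero p x =
    IsPositiveZero x × (∀ y → IsPositiveZero y → x ≤ y)
    where
    IsPositiveZero : ℝ → Set ℓ
    IsPositiveZero y = 0# < y × eval rawRing (λ a → a) y p ≈ 0#

  -- Indices start at 0 here, so the entry r^{(i-1)/2} in 1-based
  -- position (i, i+1) becomes (√r)^i in position (i, i+1).
  A : ∀ h {r} → 0# < r → Matrix h
  A h 0<r i j with toℕ j ℕ.≟ suc (toℕ i) | toℕ i ℕ.≟ suc (toℕ j)
  ... | yes _ | _     = √ (inj₁ 0<r) ^ toℕ i
  ... | no _  | yes _ = √ (inj₁ 0<r) ^ toℕ j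
  ... | no _  | no _  = 0#

  P : ℕ → ℝ → Poly
  P h r = pathPoly rawRing r h

  private
    module T  = RawRing polyRing
    module T^ = Algebra.Definitions.RawSemiring T.rawSemiring
    open Matrices polyRing using (det; 1ₘ; _-ₘ_; _·ₘ_)

  -- With T standing for √X, det(I - √X M) is computed in ℝ[T].
  detI-√X : ∀ {n} → Matrix n → Poly
  detI-√X M = det (1ₘ -ₘ indet ·ₘ mapₘ const M)

  -- f represents p as a polynomial in X = T²: that is, p(T) = f(T²).
  -- Such an f is unique, and p is then even, i.e. unchanged by T ↦ -T.
  _IsInXFor_ : Poly → Poly → Set ℓ
  f IsInXFor p = eval polyRing const (indet T^.^ 2) f ≈ₚ p

{-# OPTIONS --safe #-}

-- Expanding det (I - T A_h) along the first row gives the continuant recursion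
-- K_{h+2}(b) = K_{h+1}(b_1, b_2, …) - b_0 K_h(b_2, b_3, …) with b_k = T² r^k, and by
-- Pascal's rule P_h(X, r) satisfies the same recursion with b_k = X r^k.
--
-- Reading the continuants from the other end gives u_{k+2} = u_{k+1} - z r^k u_k for
-- u_k = P_k(z, r).  For nonreal z this recurrence keeps Im z · Im (z u_k conj u_{k+1})
-- positive, and for z ≤ 0 it keeps u_k positive, so all zeros are positive reals.
-- By induction P_{h+1} is negative at the first zero of P_h, which produces a first
-- zero x of every P_h, h ≥ 2, by the intermediate value argument.
--
-- The recurrence is also the eigenvector equation: when μ² z = 1, an eigenvector v of
-- A_h at μ has v_k proportional to μ^k u_k, and v_h = 0 is the boundary condition.
-- So μ ≠ 0 is an eigenvalue iff μ⁻² is a zero of P_h, and the spectral radius is 1/√x.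
module Submission where

open import Defs
open import Algebra.Bundles using (CommutativeRing)
open import Algebra.Bundles.Raw using (RawRing)
import Algebra.Definitions.RawSemiring
open import Algebra.Morphism.Structures using (module RingMorphisms)
import Algebra.Properties.AbelianGroup
import Algebra.Properties.CommutativeSemiring.Exp
import Algebra.Properties.Ring
import Algebra.Properties.Semiring.Mult.TCOptimised
import Algebra.Properties.Semiring.Sum
import Algebra.Solver.Ring
open import Algebra.Solver.Ring.AlmostCommutativeRing
  using (fromCommutativeRing; _-Raw-AlmostCommutative⟶_)
open import Data.Empty using (⊥-elim)
open import Data.Fin using (Fin; zero; suc; toℕ; punchIn)
import Data.Fin as Fin
import Data.Fin.Properties as Finₚ
open import Data.List using ([]; _∷_; map)
open import Data.Maybe using (Maybe; just; nothing)
open import Data.Nat as ℕ using (ℕ; zero; suc; z≤n; s≤s; _∸_; ⌊_/2⌋)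
  renaming (_≤_ to _≤ℕ_; _<_ to _<ℕ_)
import Data.Nat.Properties as ℕₚ
import Data.Nat.Tactic.RingSolver as ℕ-Tactic
open import Data.Product using (Σ; ∃; _×_; _,_; proj₁; proj₂)
open import Data.Sum using (_⊎_; inj₁; inj₂)
open import Function using (_∘_)
open import Level using (Level)
open import Relation.Binary.Definitions using (tri<; tri≈; tri>)
import Relation.Binary.PropositionalEquality as ≡
import Relation.Binary.Reasoning.Setoid
open import Relation.Nullary using (¬_; yes; no)

-- Neither the spectral theorem nor the existence of any eigenvalue is presupposed: reality of the
-- zeros is read off the recurrence, and a maximal eigenvalue has to be exhibited. It is built from
-- the first zero x, which completeness supplies.
--
-- `P_{h+1}` is negative at the first zero x of `P_h` because the recurrence reduces there to
-- `- x r^(h-1) P_{h-1}(x)`. The induction must therefore remember that `P_{h-1}` is positive up to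
-- and including x.
--
-- The spectral bound goes through reciprocals: a nonzero eigenvalue μ yields the zero z = μ⁻²,
-- which is real and positive, hence at least x, and |μ|² z = 1 gives |μ|² ≤ 1/x. The eigenvalue 0,
-- which has no reciprocal, is bounded separately.
--
-- The continuant identities involve no division, so they are proved over an arbitrary commutative
-- ring and carried along homomorphisms into ℝ[T], ℝ and ℂ.

private
  variable
    c ℓ c′ ℓ′ : Level

-- Normalisation of ring expressions with integer coefficients

-- The coefficient (a , b) stands for the integer a - b.
module RingSolver (R : CommutativeRing c ℓ) where
  open CommutativeRing R hiding (zero)
  open Algebra.Properties.Ring ring using (-‿distribˡ-*; -‿distribʳ-*; -‿involutive)
  open Algebra.Properties.AbelianGroup +-abelianGroup using (⁻¹-∙-comm; ε⁻¹≈ε)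
  open Algebra.Properties.Semiring.Mult.TCOptimised semiring using (×-homo-+; ×1-homo-*)
    renaming (_×_ to _⊠_)
  open Relation.Binary.Reasoning.Setoid setoid
  module NatSolver where
    open import Algebra.Solver.Ring.NaturalCoefficients.Default commutativeSemiring public

  private
    -- The clause for `zero` subtracts nothing, so that `con (0 , 0)` and `con (1 , 0)` reduce to
    -- `0#` and `1#` themselves and solved equations match the goals literally.
    ⟦_⟧ : ℕ × ℕ → Carrier
    ⟦ a , zero ⟧  = a ⊠ 1#
    ⟦ a , suc b ⟧ = a ⊠ 1# - suc b ⊠ 1#

    ⟦⟧-difference : ∀ a b → ⟦ a , b ⟧ ≈ a ⊠ 1# - b ⊠ 1#
    ⟦⟧-difference a zero    = sym (trans (+-congˡ ε⁻¹≈ε) (+-identityʳ _))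
    ⟦⟧-difference a (suc b) = refl

    interchange : ∀ a b d e → (a + b) + (d + e) ≈ (a + d) + (b + e)
    interchange = NatSolver.solve 4 (λ a b d e → (a :+ b) :+ (d :+ e) := (a :+ d) :+ (b :+ e)) refl
      where open NatSolver

    -- Cancelling until one component is zero gives every integer a single representative, which
    -- lets coefficients be compared componentwise.
    normalise : ℕ → ℕ → ℕ × ℕ
    normalise zero    b       = zero , b
    normalise (suc a) zero    = suc a , zero
    normalise (suc a) (suc b) = normalise a b

    ⟦normalise⟧ : ∀ a b → ⟦ normalise a b ⟧ ≈ a ⊠ 1# - b ⊠ 1#
    ⟦normalise⟧ zero    b       = ⟦⟧-difference zero b
    ⟦normalise⟧ (suc a) zero    = ⟦⟧-difference (suc a) zero
    ⟦normalise⟧ (suc a) (suc b) = begin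
      ⟦ normalise a b ⟧                        ≈⟨ ⟦normalise⟧ a b ⟩
      a ⊠ 1# - b ⊠ 1#                          ≈⟨ +-identityˡ _ ⟨
      0# + (a ⊠ 1# - b ⊠ 1#)                   ≈⟨ +-congʳ (-‿inverseʳ 1#) ⟨
      (1# - 1#) + (a ⊠ 1# - b ⊠ 1#)            ≈⟨ interchange _ _ _ _ ⟩
      (1# + a ⊠ 1#) + (- 1# + - (b ⊠ 1#))      ≈⟨ +-congˡ (⁻¹-∙-comm _ _) ⟩
      (1# + a ⊠ 1#) - (1# + b ⊠ 1#)            ≈⟨ +-cong (×-homo-+ 1# 1 a) (-‿cong (×-homo-+ 1# 1 b)) ⟨
      suc a ⊠ 1# - suc b ⊠ 1#                  ∎

    ℤ-raw : RawRing _ _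
    ℤ-raw = record
      { Carrier = ℕ × ℕ
      ; _≈_     = ≡._≡_
      ; _+_     = λ { (a , b) (d , e) → normalise (a ℕ.+ d) (b ℕ.+ e) }
      ; _*_     = λ { (a , b) (d , e) → normalise (a ℕ.* d ℕ.+ b ℕ.* e) (a ℕ.* e ℕ.+ b ℕ.* d) }
      ; -_      = λ { (a , b) → b , a }
      ; 0#      = 0 , 0
      ; 1#      = 1 , 0
      }

    -*- : ∀ x y → - x * - y ≈ x * y
    -*- x y = begin
      - x * - y     ≈⟨ -‿distribˡ-* x (- y) ⟨
      - (x * - y)   ≈⟨ -‿cong (-‿distribʳ-* x y) ⟨
      - - (x * y)   ≈⟨ -‿involutive _ ⟩
      x * y         ∎

    morphism : ℤ-raw -Raw-AlmostCommutative⟶ fromCommutativeRing R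
    morphism = record
      { ⟦_⟧    = ⟦_⟧
      ; +-homo = λ { (a , b) (d , e) → begin
          ⟦ normalise (a ℕ.+ d) (b ℕ.+ e) ⟧                    ≈⟨ ⟦normalise⟧ (a ℕ.+ d) (b ℕ.+ e) ⟩
          (a ℕ.+ d) ⊠ 1# - (b ℕ.+ e) ⊠ 1#                      ≈⟨ +-cong (×-homo-+ 1# a d) (-‿cong (×-homo-+ 1# b e)) ⟩
          (a ⊠ 1# + d ⊠ 1#) - (b ⊠ 1# + e ⊠ 1#)                ≈⟨ +-congˡ (⁻¹-∙-comm _ _) ⟨
          (a ⊠ 1# + d ⊠ 1#) + (- (b ⊠ 1#) + - (e ⊠ 1#))        ≈⟨ interchange _ _ _ _ ⟩
          (a ⊠ 1# - b ⊠ 1#) + (d ⊠ 1# - e ⊠ 1#)                ≈⟨ +-cong (⟦⟧-difference a b) (⟦⟧-difference d e) ⟨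
          ⟦ a , b ⟧ + ⟦ d , e ⟧                                ∎ }
      ; *-homo = λ { (a , b) (d , e) → begin
          ⟦ normalise (a ℕ.* d ℕ.+ b ℕ.* e) (a ℕ.* e ℕ.+ b ℕ.* d) ⟧
            ≈⟨ ⟦normalise⟧ (a ℕ.* d ℕ.+ b ℕ.* e) _ ⟩
          (a ℕ.* d ℕ.+ b ℕ.* e) ⊠ 1# - (a ℕ.* e ℕ.+ b ℕ.* d) ⊠ 1#
            ≈⟨ +-cong (homo₂ a d b e) (-‿cong (homo₂ a e b d)) ⟩
          (a ⊠ 1# * d ⊠ 1# + b ⊠ 1# * e ⊠ 1#) - (a ⊠ 1# * e ⊠ 1# + b ⊠ 1# * d ⊠ 1#)
            ≈⟨ +-cong (+-congˡ (sym (-*- _ _)))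
                      (trans (sym (⁻¹-∙-comm _ _)) (+-cong (-‿distribʳ-* _ _) (-‿distribˡ-* _ _))) ⟩
          (a ⊠ 1# * d ⊠ 1# + - (b ⊠ 1#) * - (e ⊠ 1#)) + (a ⊠ 1# * - (e ⊠ 1#) + - (b ⊠ 1#) * d ⊠ 1#)
            ≈⟨ expand _ _ _ _ ⟩
          (a ⊠ 1# - b ⊠ 1#) * (d ⊠ 1# - e ⊠ 1#)
            ≈⟨ *-cong (⟦⟧-difference a b) (⟦⟧-difference d e) ⟨
          ⟦ a , b ⟧ * ⟦ d , e ⟧ ∎ }
      ; -‿homo = λ { (a , b) → begin
          ⟦ b , a ⟧                  ≈⟨ ⟦⟧-difference b a ⟩
          b ⊠ 1# - a ⊠ 1#            ≈⟨ +-comm _ _ ⟩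
          - (a ⊠ 1#) + b ⊠ 1#        ≈⟨ +-congˡ (-‿involutive _) ⟨
          - (a ⊠ 1#) - - (b ⊠ 1#)    ≈⟨ ⁻¹-∙-comm _ _ ⟩
          - (a ⊠ 1# - b ⊠ 1#)        ≈⟨ -‿cong (⟦⟧-difference a b) ⟨
          - ⟦ a , b ⟧                ∎ }
      ; 0-homo = refl
      ; 1-homo = refl
      }
      where
      homo₂ : ∀ a d b e → (a ℕ.* d ℕ.+ b ℕ.* e) ⊠ 1# ≈ a ⊠ 1# * d ⊠ 1# + b ⊠ 1# * e ⊠ 1#
      homo₂ a d b e = trans (×-homo-+ 1# (a ℕ.* d) (b ℕ.* e)) (+-cong (×1-homo-* a d) (×1-homo-* b e))

      expand : ∀ a b d e → (a * d + b * e) + (a * e + b * d) ≈ (a + b) * (d + e)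
      expand = NatSolver.solve 4 (λ a b d e →
        (a :* d :+ b :* e) :+ (a :* e :+ b :* d) := (a :+ b) :* (d :+ e)) refl
        where open NatSolver

    _≟_ : ∀ x y → Maybe (⟦ x ⟧ ≈ ⟦ y ⟧)
    (a , b) ≟ (d , e) with a ℕ.≟ d | b ℕ.≟ e
    ... | yes ≡.refl | yes ≡.refl = just refl
    ... | _          | _          = nothing

  open Algebra.Solver.Ring ℤ-raw (fromCommutativeRing R) morphism _≟_ public
    using (solve; _:=_; _:+_; _:*_; _:-_; :-_; con)

-- Ring homomorphisms, powers and Gaussian binomials

module Homomorphisms (R : CommutativeRing c ℓ) (S : CommutativeRing c′ ℓ′) where
  private
    module R = CommutativeRing R
    module S = CommutativeRing S
    module R^ = Algebra.Definitions.RawSemiring (RawRing.rawSemiring R.rawRing)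
    module S^ = Algebra.Definitions.RawSemiring (RawRing.rawSemiring S.rawRing)
  open RingMorphisms R.rawRing S.rawRing public using (IsRingHomomorphism)

  ringHomomorphism : ∀ {f} → (∀ {x y} → x R.≈ y → f x S.≈ f y) →
    (∀ x y → f (x R.+ y) S.≈ f x S.+ f y) → (∀ x y → f (x R.* y) S.≈ f x S.* f y) →
    (∀ x → f (R.- x) S.≈ S.- f x) → f R.0# S.≈ S.0# → f R.1# S.≈ S.1# → IsRingHomomorphism f
  ringHomomorphism cong +-h *-h neg-h 0-h 1-h = record
    { isSemiringHomomorphism = record
      { isNearSemiringHomomorphism = record
        { +-isMonoidHomomorphism = record
          { isMagmaHomomorphism = record { isRelHomomorphism = record { cong = cong } ; homo = +-h }
          ; ε-homo = 0-h }
        ; *-homo = *-h }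
      ; 1#-homo = 1-h }
    ; -‿homo = neg-h }

  module _ {f : R.Carrier → S.Carrier} (hom : IsRingHomomorphism f) where
    open RingMorphisms.IsRingHomomorphism hom

    ^-homo : ∀ x n → f (x R^.^ n) S.≈ f x S^.^ n
    ^-homo x zero    = 1#-homo
    ^-homo x (suc n) = S.trans (*-homo _ _) (S.*-congˡ (^-homo x n))

    gauss-homo : ∀ q n m → f (gauss R.rawRing q n m) S.≈ gauss S.rawRing (f q) n m
    gauss-homo q n       zero    = 1#-homo
    gauss-homo q zero    (suc m) = 0#-homo
    gauss-homo q (suc n) (suc m) = S.trans (+-homo _ _) (S.+-cong (gauss-homo q n m)
      (S.trans (*-homo _ _) (S.*-cong (^-homo q (suc m)) (gauss-homo q n (suc m)))))

-- The commutative ring of polynomials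

module PolynomialRing (R : CommutativeRing c ℓ) where
  open CommutativeRing R hiding (zero)
  open Polynomials rawRing
  open RingSolver R
  open Relation.Binary.Reasoning.Setoid setoid

  infixl 7 _⊛_
  -- The Cauchy product of coefficient sequences. Equality of polynomials is coefficientwise, so the
  -- ring laws are proved for sequences, where trailing zeros and list lengths play no part, and
  -- transferred by `coeff-*`.
  _⊛_ : (ℕ → Carrier) → (ℕ → Carrier) → ℕ → Carrier
  (f ⊛ g) zero    = f 0 * g 0
  (f ⊛ g) (suc k) = f 0 * g (suc k) + ((f ∘ suc) ⊛ g) k

  ⊛-cong : ∀ {f f′ g g′} → (∀ k → f k ≈ f′ k) → (∀ k → g k ≈ g′ k) → ∀ k → (f ⊛ g) k ≈ (f′ ⊛ g′) k
  ⊛-cong p q zero    = *-cong (p 0) (q 0)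
  ⊛-cong p q (suc k) = +-cong (*-cong (p 0) (q (suc k))) (⊛-cong (p ∘ suc) q k)

  ⊛-zeroˡ : ∀ {f} g → (∀ k → f k ≈ 0#) → ∀ k → (f ⊛ g) k ≈ 0#
  ⊛-zeroˡ g p zero    = trans (*-congʳ (p 0)) (zeroˡ _)
  ⊛-zeroˡ g p (suc k) = trans (+-cong (trans (*-congʳ (p 0)) (zeroˡ _)) (⊛-zeroˡ g (p ∘ suc) k)) (+-identityˡ _)

  ⊛-distribʳ : ∀ f g h k → ((λ i → g i + h i) ⊛ f) k ≈ (g ⊛ f) k + (h ⊛ f) k
  ⊛-distribʳ f g h zero    = distribʳ _ _ _
  ⊛-distribʳ f g h (suc k) = trans (+-congˡ (⊛-distribʳ f (g ∘ suc) (h ∘ suc) k))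
    (solve 5 (λ a b d e x → (a :+ b) :* x :+ (d :+ e) := (a :* x :+ d) :+ (b :* x :+ e)) refl
      (g 0) (h 0) _ _ (f (suc k)))

  ⊛-scaleˡ : ∀ a f g k → ((λ i → a * f i) ⊛ g) k ≈ a * (f ⊛ g) k
  ⊛-scaleˡ a f g zero    = *-assoc _ _ _
  ⊛-scaleˡ a f g (suc k) = trans (+-congˡ (⊛-scaleˡ a (f ∘ suc) g k))
    (solve 4 (λ a b d e → (a :* b) :* d :+ a :* e := a :* (b :* d :+ e)) refl a (f 0) _ _)

  -- The definition peels off the lowest coefficient of the left factor; this is the mirror image,
  -- peeling the right factor, and commutativity follows by comparing the two.
  ⊛-sucʳ : ∀ f g k → (f ⊛ g) (suc k) ≈ f (suc k) * g 0 + (f ⊛ (g ∘ suc)) k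
  ⊛-sucʳ f g zero    = +-comm _ _
  ⊛-sucʳ f g (suc k) = trans (+-congˡ (⊛-sucʳ (f ∘ suc) g k))
    (solve 3 (λ a b d → a :+ (b :+ d) := b :+ (a :+ d)) refl _ _ _)

  ⊛-comm : ∀ f g k → (f ⊛ g) k ≈ (g ⊛ f) k
  ⊛-comm f g zero    = *-comm _ _
  ⊛-comm f g (suc k) = trans (+-cong (*-comm _ _) (⊛-comm (f ∘ suc) g k)) (sym (⊛-sucʳ g f k))

  ⊛-assoc : ∀ f g h k → ((f ⊛ g) ⊛ h) k ≈ (f ⊛ (g ⊛ h)) k
  ⊛-assoc f g h zero    = *-assoc _ _ _
  ⊛-assoc f g h (suc k) = begin
    (f 0 * g 0) * h (suc k) + ((λ i → f 0 * g (suc i) + ((f ∘ suc) ⊛ g) i) ⊛ h) k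
      ≈⟨ +-congˡ (⊛-distribʳ h _ ((f ∘ suc) ⊛ g) k) ⟩
    (f 0 * g 0) * h (suc k) + (((λ i → f 0 * g (suc i)) ⊛ h) k + (((f ∘ suc) ⊛ g) ⊛ h) k)
      ≈⟨ +-congˡ (+-cong (⊛-scaleˡ (f 0) (g ∘ suc) h k) (⊛-assoc (f ∘ suc) g h k)) ⟩
    (f 0 * g 0) * h (suc k) + (f 0 * ((g ∘ suc) ⊛ h) k + ((f ∘ suc) ⊛ (g ⊛ h)) k)
      ≈⟨ solve 5 (λ a b d e z → (a :* b) :* d :+ (a :* e :+ z) := a :* (b :* d :+ e) :+ z) refl
           (f 0) (g 0) (h (suc k)) _ _ ⟩
    f 0 * (g 0 * h (suc k) + ((g ∘ suc) ⊛ h) k) + ((f ∘ suc) ⊛ (g ⊛ h)) k ∎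

  coeff-+ : ∀ p q k → coeff (p +ₚ q) k ≈ coeff p k + coeff q k
  coeff-+ []      q       k       = sym (+-identityˡ _)
  coeff-+ (a ∷ p) []      k       = sym (+-identityʳ _)
  coeff-+ (a ∷ p) (b ∷ q) zero    = refl
  coeff-+ (a ∷ p) (b ∷ q) (suc k) = coeff-+ p q k

  coeff-neg : ∀ p k → coeff (map (-_) p) k ≈ - coeff p k
  coeff-neg []      k       = solve 0 (con (0 , 0) := :- con (0 , 0)) refl
  coeff-neg (a ∷ p) zero    = refl
  coeff-neg (a ∷ p) (suc k) = coeff-neg p k

  coeff-scale : ∀ a p k → coeff (map (a *_) p) k ≈ a * coeff p k
  coeff-scale a []      k       = sym (zeroʳ a)
  coeff-scale a (b ∷ p) zero    = refl
  coeff-scale a (b ∷ p) (suc k) = coeff-scale a p k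

  coeff-* : ∀ p q k → coeff (p *ₚ q) k ≈ (coeff p ⊛ coeff q) k
  coeff-* []      q k       = sym (⊛-zeroˡ (coeff q) (λ _ → refl) k)
  coeff-* (a ∷ p) q zero    = trans (coeff-+ (map (a *_) q) _ 0)
    (trans (+-identityʳ _) (coeff-scale a q 0))
  coeff-* (a ∷ p) q (suc k) = trans (coeff-+ (map (a *_) q) _ (suc k))
    (+-cong (coeff-scale a q (suc k)) (coeff-* p q k))

  private
    ⊛-identityˡ : ∀ g k → (coeff (1# ∷ []) ⊛ g) k ≈ g k
    ⊛-identityˡ g zero    = *-identityˡ _
    ⊛-identityˡ g (suc k) = trans (+-cong (*-identityˡ _) (⊛-zeroˡ g (λ _ → refl) k)) (+-identityʳ _)

    *-commₚ : ∀ p q → p *ₚ q ≈ₚ q *ₚ p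
    *-commₚ p q k = trans (coeff-* p q k) (trans (⊛-comm (coeff p) (coeff q) k) (sym (coeff-* q p k)))

    *-congₚ : ∀ {p p′ q q′} → p ≈ₚ p′ → q ≈ₚ q′ → p *ₚ q ≈ₚ p′ *ₚ q′
    *-congₚ {p} {p′} {q} {q′} e e′ k =
      trans (coeff-* p q k) (trans (⊛-cong e e′ k) (sym (coeff-* p′ q′ k)))

    *-assocₚ : ∀ p q r → (p *ₚ q) *ₚ r ≈ₚ p *ₚ (q *ₚ r)
    *-assocₚ p q r k = begin
      coeff ((p *ₚ q) *ₚ r) k             ≈⟨ coeff-* (p *ₚ q) r k ⟩
      (coeff (p *ₚ q) ⊛ coeff r) k        ≈⟨ ⊛-cong (coeff-* p q) (λ _ → refl) k ⟩
      ((coeff p ⊛ coeff q) ⊛ coeff r) k   ≈⟨ ⊛-assoc (coeff p) (coeff q) (coeff r) k ⟩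
      (coeff p ⊛ (coeff q ⊛ coeff r)) k   ≈⟨ ⊛-cong (λ _ → refl) (coeff-* q r) k ⟨
      (coeff p ⊛ coeff (q *ₚ r)) k        ≈⟨ coeff-* p (q *ₚ r) k ⟨
      coeff (p *ₚ (q *ₚ r)) k             ∎

    *-identityˡₚ : ∀ p → (1# ∷ []) *ₚ p ≈ₚ p
    *-identityˡₚ p k = trans (coeff-* (1# ∷ []) p k) (⊛-identityˡ (coeff p) k)

    distribʳₚ : ∀ p q r → (q +ₚ r) *ₚ p ≈ₚ (q *ₚ p) +ₚ (r *ₚ p)
    distribʳₚ p q r k = begin
      coeff ((q +ₚ r) *ₚ p) k                        ≈⟨ coeff-* (q +ₚ r) p k ⟩
      (coeff (q +ₚ r) ⊛ coeff p) k                   ≈⟨ ⊛-cong (coeff-+ q r) (λ _ → refl) k ⟩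
      ((λ i → coeff q i + coeff r i) ⊛ coeff p) k    ≈⟨ ⊛-distribʳ (coeff p) (coeff q) (coeff r) k ⟩
      (coeff q ⊛ coeff p) k + (coeff r ⊛ coeff p) k  ≈⟨ +-cong (coeff-* q p k) (coeff-* r p k) ⟨
      coeff (q *ₚ p) k + coeff (r *ₚ p) k            ≈⟨ coeff-+ (q *ₚ p) (r *ₚ p) k ⟨
      coeff ((q *ₚ p) +ₚ (r *ₚ p)) k                 ∎

    +-congₚ : ∀ {p p′ q q′} → p ≈ₚ p′ → q ≈ₚ q′ → p +ₚ q ≈ₚ p′ +ₚ q′
    +-congₚ {p} {p′} {q} {q′} e e′ k =
      trans (coeff-+ p q k) (trans (+-cong (e k) (e′ k)) (sym (coeff-+ p′ q′ k)))

    +-commₚ : ∀ p q → p +ₚ q ≈ₚ q +ₚ p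
    +-commₚ p q k = trans (coeff-+ p q k) (trans (+-comm _ _) (sym (coeff-+ q p k)))

    +-assocₚ : ∀ p q r → (p +ₚ q) +ₚ r ≈ₚ p +ₚ (q +ₚ r)
    +-assocₚ p q r k = begin
      coeff ((p +ₚ q) +ₚ r) k              ≈⟨ coeff-+ (p +ₚ q) r k ⟩
      coeff (p +ₚ q) k + coeff r k         ≈⟨ +-congʳ (coeff-+ p q k) ⟩
      (coeff p k + coeff q k) + coeff r k  ≈⟨ +-assoc _ _ _ ⟩
      coeff p k + (coeff q k + coeff r k)  ≈⟨ +-congˡ (coeff-+ q r k) ⟨
      coeff p k + coeff (q +ₚ r) k         ≈⟨ coeff-+ p (q +ₚ r) k ⟨
      coeff (p +ₚ (q +ₚ r)) k              ∎

    -‿inverseˡₚ : ∀ p → map (-_) p +ₚ p ≈ₚ []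
    -‿inverseˡₚ p k = trans (coeff-+ (map (-_) p) p k) (trans (+-congʳ (coeff-neg p k)) (-‿inverseˡ _))

    -‿congₚ : ∀ {p q} → p ≈ₚ q → map (-_) p ≈ₚ map (-_) q
    -‿congₚ {p} {q} e k = trans (coeff-neg p k) (trans (-‿cong (e k)) (sym (coeff-neg q k)))

  polynomialRing : CommutativeRing c ℓ
  polynomialRing = record
    { Carrier = Poly
    ; _≈_     = _≈ₚ_
    ; _+_     = _+ₚ_
    ; _*_     = _*ₚ_
    ; -_      = map (-_)
    ; 0#      = []
    ; 1#      = 1# ∷ []
    ; isCommutativeRing = record
      { isRing = record
        { +-isAbelianGroup = record
          { isGroup = record
            { isMonoid = record
              { isSemigroup = record
                { isMagma = record
                  { isEquivalence = record
                    { refl  = λ _ → refl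
                    ; sym   = λ e k → sym (e k)
                    ; trans = λ e e′ k → trans (e k) (e′ k)
                    }
                  ; ∙-cong = λ {p} {p′} {q} {q′} → +-congₚ {p} {p′} {q} {q′}
                  }
                ; assoc = +-assocₚ
                }
              ; identity = (λ p k → refl) , λ p k → trans (coeff-+ p [] k) (+-identityʳ _)
              }
            ; inverse = -‿inverseˡₚ , λ p k → trans (+-commₚ p (map (-_) p) k) (-‿inverseˡₚ p k)
            ; ⁻¹-cong = λ {p} {q} → -‿congₚ {p} {q}
            }
          ; comm = +-commₚ
          }
        ; *-cong     = λ {p} {p′} {q} {q′} → *-congₚ {p} {p′} {q} {q′}
        ; *-assoc    = *-assocₚ
        ; *-identity = *-identityˡₚ , λ p k → trans (*-commₚ p (1# ∷ []) k) (*-identityˡₚ p k)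
        ; distrib    =
            (λ p q r k → trans (*-commₚ p (q +ₚ r) k) (trans (distribʳₚ p q r k)
              (+-congₚ {q *ₚ p} {p *ₚ q} {r *ₚ p} {p *ₚ r} (*-commₚ q p) (*-commₚ r p) k)))
            , distribʳₚ
        }
      ; *-comm = *-commₚ
      }
    }

  open Homomorphisms R polynomialRing

  const-homomorphism : IsRingHomomorphism const
  const-homomorphism = ringHomomorphism
    (λ { e zero → e ; e (suc k) → refl })
    (λ { a b zero → refl ; a b (suc k) → refl })
    (λ { a b zero → sym (+-identityʳ _) ; a b (suc zero) → refl ; a b (suc (suc k)) → refl })
    (λ { a zero → refl ; a (suc k) → refl })
    (λ { zero → refl ; (suc k) → refl })
    (λ { zero → refl ; (suc k) → refl })

-- Evaluation as a ring homomorphism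

module Evaluation (R : CommutativeRing c ℓ) (S : CommutativeRing c′ ℓ′)
  {ι : CommutativeRing.Carrier R → CommutativeRing.Carrier S}
  (hom : Homomorphisms.IsRingHomomorphism R S ι) (x : CommutativeRing.Carrier S) where
  private
    module R = CommutativeRing R
  open CommutativeRing S hiding (zero)
  open RingMorphisms.IsRingHomomorphism hom
  open Polynomials R.rawRing
  open PolynomialRing R using (polynomialRing)
  open RingSolver S

  ev : Poly → Carrier
  ev = eval rawRing ι x

  private
    -- A list equal to the zero polynomial may still be a nonempty list of zeros, so congruence of
    -- evaluation cannot be proved by matching the two lists alone.
    ev-≈[] : ∀ p → p ≈ₚ [] → ev p ≈ 0#
    ev-≈[] []      e = refl
    ev-≈[] (a ∷ p) e = trans (+-cong (trans (⟦⟧-cong (e 0)) 0#-homo)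
      (trans (*-congˡ (ev-≈[] p (e ∘ suc))) (zeroʳ x))) (+-identityˡ _)

    ev-cong : ∀ p q → p ≈ₚ q → ev p ≈ ev q
    ev-cong []      q       e = sym (ev-≈[] q (λ k → R.sym (e k)))
    ev-cong (a ∷ p) []      e = ev-≈[] (a ∷ p) e
    ev-cong (a ∷ p) (b ∷ q) e = +-cong (⟦⟧-cong (e 0)) (*-congˡ (ev-cong p q (e ∘ suc)))

    ev-+ : ∀ p q → ev (p +ₚ q) ≈ ev p + ev q
    ev-+ []      q       = sym (+-identityˡ _)
    ev-+ (a ∷ p) []      = sym (+-identityʳ _)
    ev-+ (a ∷ p) (b ∷ q) = trans (+-cong (+-homo a b) (*-congˡ (ev-+ p q)))
      (solve 5 (λ a b x p q → (a :+ b) :+ x :* (p :+ q) := (a :+ x :* p) :+ (b :+ x :* q)) refl _ _ _ _ _)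

    ev-scale : ∀ a p → ev (map (a R.*_) p) ≈ ι a * ev p
    ev-scale a []      = sym (zeroʳ _)
    ev-scale a (b ∷ p) = trans (+-cong (*-homo a b) (*-congˡ (ev-scale a p)))
      (solve 4 (λ a b x p → a :* b :+ x :* (a :* p) := a :* (b :+ x :* p)) refl _ _ _ _)

    ev-* : ∀ p q → ev (p *ₚ q) ≈ ev p * ev q
    ev-* []      q = sym (zeroˡ _)
    ev-* (a ∷ p) q = trans (ev-+ (map (a R.*_) q) _)
      (trans (+-cong (ev-scale a q) (+-cong 0#-homo (*-congˡ (ev-* p q))))
      (solve 4 (λ a x p q → a :* q :+ (con (0 , 0) :+ x :* (p :* q)) := (a :+ x :* p) :* q) refl _ _ _ _))

    ev-neg : ∀ p → ev (map (R.-_) p) ≈ - ev p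
    ev-neg []      = solve 0 (con (0 , 0) := :- con (0 , 0)) refl
    ev-neg (a ∷ p) = trans (+-cong (-‿homo a) (*-congˡ (ev-neg p)))
      (solve 3 (λ a x p → :- a :+ x :* (:- p) := :- (a :+ x :* p)) refl _ _ _)

  eval-const : ∀ a → ev (const a) ≈ ι a
  eval-const a = trans (+-congˡ (zeroʳ x)) (+-identityʳ _)

  eval-indet : ev indet ≈ x
  eval-indet = trans (+-cong 0#-homo (*-congˡ (trans (eval-const R.1#) 1#-homo)))
    (trans (+-identityˡ _) (*-identityʳ x))

  eval-homomorphism : Homomorphisms.IsRingHomomorphism polynomialRing S ev
  eval-homomorphism = Homomorphisms.ringHomomorphism polynomialRing S
    (λ {p} {q} → ev-cong p q) ev-+ ev-* ev-neg refl (trans (eval-const R.1#) 1#-homo)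

-- Continuants and their expansion at either end

module Continuants (R : CommutativeRing c ℓ) where
  open CommutativeRing R hiding (zero)
  open RingSolver R
  open Relation.Binary.Reasoning.Setoid setoid

  -- The weights form an infinite sequence, so deleting the first vertex of the path is the shift
  -- `b ∘ suc`; for weights `x * q ^ k` this shift replaces x by x q.
  continuant : (ℕ → Carrier) → ℕ → Carrier
  continuant b zero          = 1#
  continuant b (suc zero)    = 1#
  continuant b (suc (suc n)) =
    continuant (b ∘ suc) (suc n) - b 0 * continuant (λ k → b (suc (suc k))) n

  -‿cong₂ : ∀ {w x y z} → w ≈ x → y ≈ z → w - y ≈ x - z
  -‿cong₂ p q = +-cong p (-‿cong q)

  continuant-cong : ∀ {b d} → (∀ k → b k ≈ d k) → ∀ n → continuant b n ≈ continuant d n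
  continuant-cong p zero          = refl
  continuant-cong p (suc zero)    = refl
  continuant-cong p (suc (suc n)) = -‿cong₂ (continuant-cong (p ∘ suc) (suc n))
    (*-cong (p 0) (continuant-cong (λ k → p (suc (suc k))) n))

  -- Expansions at opposite ends commute: expanding both shifted continuants at the last weight
  -- leaves four terms, which regroup into first-end expansions of the two shorter continuants. The
  -- two-step recursion makes n = 1 a second base case.
  continuant-last : ∀ b n →
    continuant b (suc (suc n)) ≈ continuant b (suc n) - b n * continuant b n
  continuant-last b zero          = refl
  continuant-last b (suc zero)    =
    solve 2 (λ x y → (con (1 , 0) :- y :* con (1 , 0)) :- x :* con (1 , 0) :=
                     (con (1 , 0) :- x :* con (1 , 0)) :- y :* con (1 , 0)) refl (b 0) (b 1)
  continuant-last b (suc (suc n)) = trans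
    (-‿cong₂ (continuant-last (b ∘ suc) (suc n)) (*-congˡ (continuant-last (λ k → b (suc (suc k))) n)))
    (solve 6 (λ x y p q s t → (p :- y :* q) :- x :* (s :- y :* t) :=
                              (p :- x :* s) :- y :* (q :- x :* t)) refl (b 0) (b (suc (suc n))) _ _ _ _)

module ContinuantHomomorphism (R : CommutativeRing c ℓ) (S : CommutativeRing c′ ℓ′)
  {f : CommutativeRing.Carrier R → CommutativeRing.Carrier S}
  (hom : Homomorphisms.IsRingHomomorphism R S f) where
  open CommutativeRing S hiding (zero)
  open RingMorphisms.IsRingHomomorphism hom
  private
    module R = Continuants R
    module S = Continuants S

  continuant-homo : ∀ b n → f (R.continuant b n) ≈ S.continuant (f ∘ b) n
  continuant-homo b zero          = 1#-homo
  continuant-homo b (suc zero)    = 1#-homo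
  continuant-homo b (suc (suc n)) = trans (+-homo _ _)
    (+-cong (continuant-homo (b ∘ suc) (suc n))
      (trans (-‿homo _) (-‿cong (trans (*-homo _ _) (*-congˡ (continuant-homo (λ k → b (suc (suc k))) n))))))

-- Determinants of tridiagonal matrices

module Determinants (R : CommutativeRing c ℓ) where
  open CommutativeRing R hiding (zero)
  open Matrices rawRing
  open Continuants R
  open RingSolver R
  open Algebra.Properties.Semiring.Sum semiring using (sum; sum-cong-≋; sum-replicate-zero)
  open Algebra.Definitions.RawSemiring (RawRing.rawSemiring rawRing) using (_^_)
  open Relation.Binary.Reasoning.Setoid setoid

  sum-zero : ∀ {n} {f : Fin n → Carrier} → (∀ i → f i ≈ 0#) → sum f ≈ 0#
  sum-zero {n} p = trans (sum-cong-≋ p) (sum-replicate-zero n)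

  det-cong : ∀ {n} {M N : Matrix n} → (∀ i j → M i j ≈ N i j) → det M ≈ det N
  det-cong {zero}  p = refl
  det-cong {suc n} p = sum-cong-≋ λ j → *-congˡ {(- 1#) ^ toℕ j}
    (*-cong (p zero j) (det-cong λ i k → p (suc i) (punchIn j k)))

  private
    term-zeroˡ : ∀ {s x d} → x ≈ 0# → s * (x * d) ≈ 0#
    term-zeroˡ p = trans (*-congˡ (trans (*-congʳ p) (zeroˡ _))) (zeroʳ _)

    term-zeroʳ : ∀ {s x d} → d ≈ 0# → s * (x * d) ≈ 0#
    term-zeroʳ p = trans (*-congˡ (trans (*-congˡ p) (zeroʳ _))) (zeroʳ _)

  -- In the expansion along the first row, the first term has a zero entry, and every other minor
  -- keeps column `zero`, so induction applies to it.
  det-zero-column : ∀ {n} (M : Matrix (suc n)) → (∀ i → M i zero ≈ 0#) → det M ≈ 0#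
  det-zero-column {zero}  M p = trans (+-identityʳ _) (term-zeroˡ (p zero))
  det-zero-column {suc n} M p = trans
    (+-cong (term-zeroˡ {1#} (p zero)) (sum-zero λ j → term-zeroʳ {(- 1#) ^ suc (toℕ j)} {M zero (suc j)}
      (det-zero-column (λ i k → M (suc i) (punchIn (suc j) k)) (p ∘ suc))))
    (+-identityʳ _)

  -- Serves the minor belonging to the entry (0, 1) of a tridiagonal matrix: its first column has
  -- only its top entry left, whereas `det` expands along rows.
  det-first-column : ∀ {n} (M : Matrix (suc n)) → (∀ i → M (suc i) zero ≈ 0#) →
    det M ≈ M zero zero * det λ i j → M (suc i) (suc j)
  det-first-column {zero}  M p = trans (+-identityʳ _) (*-identityˡ _)
  det-first-column {suc n} M p = trans
    (+-cong (*-identityˡ _) (sum-zero λ j → term-zeroʳ {(- 1#) ^ suc (toℕ j)} {M zero (suc j)}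
      (det-zero-column (λ i k → M (suc i) (punchIn (suc j) k)) p)))
    (+-identityʳ _)

  det-tridiagonal : ∀ {n} (M : Matrix (suc (suc n))) →
    (∀ j → M zero (suc (suc j)) ≈ 0#) → (∀ i → M (suc (suc i)) zero ≈ 0#) →
    det M ≈ M zero zero * det (λ i j → M (suc i) (suc j))
            - (M zero (suc zero) * M (suc zero) zero) * det (λ i j → M (suc (suc i)) (suc (suc j)))
  det-tridiagonal M row column = begin
    1# * (M₀₀ * D₁) + ((- 1# * 1#) * (M₀₁ * det N) + sum rest)
      ≈⟨ +-congˡ (+-cong (*-congˡ (*-congˡ (det-first-column N column)))
           (sum-zero λ j → term-zeroˡ {(- 1#) ^ suc (suc (toℕ j))} (row j))) ⟩
    1# * (M₀₀ * D₁) + ((- 1# * 1#) * (M₀₁ * (M₁₀ * D₂)) + 0#)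
      ≈⟨ solve 5 (λ a d x y e →
           con (1 , 0) :* (a :* d) :+ ((:- con (1 , 0) :* con (1 , 0)) :* (x :* (y :* e)) :+ con (0 , 0)) :=
           a :* d :- (x :* y) :* e) refl M₀₀ D₁ M₀₁ M₁₀ D₂ ⟩
    M₀₀ * D₁ - (M₀₁ * M₁₀) * D₂ ∎
    where
    M₀₀ = M zero zero
    M₀₁ = M zero (suc zero)
    M₁₀ = M (suc zero) zero
    D₁  = det λ i j → M (suc i) (suc j)
    D₂  = det λ i j → M (suc (suc i)) (suc (suc j))
    N : Matrix _
    N i k = M (suc i) (punchIn (suc zero) k)
    rest : Fin _ → Carrier
    rest j = (- 1#) ^ suc (suc (toℕ j)) *
             (M zero (suc (suc j)) * det λ i k → M (suc i) (punchIn (suc (suc j)) k))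

  -- The matrix is taken on all of ℕ, finite ones being its corners. Writing the distant index as
  -- `suc (suc (i ℕ.+ j))` instead of assuming an inequality makes the conditions pass to the
  -- shifted matrix by computation.
  record IsUnitTridiagonal (m : ℕ → ℕ → Carrier) (b : ℕ → Carrier) : Set ℓ where
    field
      diagonal : ∀ i → m i i ≈ 1#
      adjacent : ∀ i → m i (suc i) * m (suc i) i ≈ b i
      above    : ∀ i j → m i (suc (suc (i ℕ.+ j))) ≈ 0#
      below    : ∀ i j → m (suc (suc (i ℕ.+ j))) i ≈ 0#

  IsUnitTridiagonal-suc : ∀ {m b} → IsUnitTridiagonal m b →
    IsUnitTridiagonal (λ i j → m (suc i) (suc j)) (b ∘ suc)
  IsUnitTridiagonal-suc t = record
    { diagonal = diagonal ∘ suc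
    ; adjacent = adjacent ∘ suc
    ; above    = above ∘ suc
    ; below    = below ∘ suc
    }
    where open IsUnitTridiagonal t

  det-continuant : ∀ {m b} → IsUnitTridiagonal m b → ∀ n →
    det {n} (λ i j → m (toℕ i) (toℕ j)) ≈ continuant b n
  det-continuant t zero          = refl
  det-continuant t (suc zero)    =
    trans (+-identityʳ _) (trans (*-identityˡ _) (trans (*-identityʳ _) (IsUnitTridiagonal.diagonal t 0)))
  det-continuant {m} {b} t (suc (suc n)) = begin
    det {suc (suc n)} (λ i j → m (toℕ i) (toℕ j))
      ≈⟨ det-tridiagonal {n} (λ i j → m (toℕ i) (toℕ j)) (above 0 ∘ toℕ) (below 0 ∘ toℕ) ⟩
    m 0 0 * D₁ - (m 0 1 * m 1 0) * D₂
      ≈⟨ -‿cong₂ (trans (*-congʳ (diagonal 0)) (*-identityˡ D₁)) (*-congʳ (adjacent 0)) ⟩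
    D₁ - b 0 * D₂
      ≈⟨ -‿cong₂ (det-continuant (IsUnitTridiagonal-suc t) (suc n))
                 (*-congˡ (det-continuant (IsUnitTridiagonal-suc (IsUnitTridiagonal-suc t)) n)) ⟩
    continuant b (suc (suc n)) ∎
    where
    open IsUnitTridiagonal t
    D₁ = det {suc n} λ i j → m (suc (toℕ i)) (suc (toℕ j))
    D₂ = det {n} λ i j → m (suc (suc (toℕ i))) (suc (suc (toℕ j)))

-- The Gaussian binomial sum as a continuant

module PathSum (R : CommutativeRing c ℓ) where
  open CommutativeRing R hiding (zero)
  open Continuants R
  open RingSolver R
  open Algebra.Definitions.RawSemiring (RawRing.rawSemiring rawRing) using (_^_)
  open Algebra.Properties.CommutativeSemiring.Exp commutativeSemiring
    using (^-homo-*; ^-distrib-*; ^-assocʳ; ^-congˡ)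
  open Algebra.Properties.Semiring.Sum semiring
    using (sum; sum-cong-≋; ∑-distrib-+; *-distribˡ-sum; sum-replicate-zero)
  open Relation.Binary.Reasoning.Setoid setoid

  pathTerm : Carrier → Carrier → ℕ → ℕ → Carrier
  pathTerm q x h m = (- x) ^ m * (q ^ (m ℕ.* (m ∸ 1)) * gauss rawRing q (h ∸ m) m)

  module _ (q : Carrier) where
    private
      g = gauss rawRing q

    -- For m > n both sides vanish, so Pascal's rule survives truncated subtraction.
    gauss-pascal-∸ : ∀ n m → g (suc n ∸ m) (suc m) ≈ g (n ∸ m) m + q ^ suc m * g (n ∸ m) (suc m)
    gauss-pascal-∸ n m with m ℕ.≤? n
    ... | yes m≤n rewrite ℕₚ.+-∸-assoc 1 m≤n = refl
    gauss-pascal-∸ n zero | no m≰n with () ← m≰n z≤n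
    gauss-pascal-∸ n (suc m) | no m≰n
      rewrite ℕₚ.m≤n⇒m∸n≡0 {n} {m} (ℕₚ.≤-pred (ℕₚ.≰⇒> m≰n))
            | ℕₚ.m≤n⇒m∸n≡0 {n} {suc m} (ℕₚ.<⇒≤ (ℕₚ.≰⇒> m≰n)) =
      sym (trans (+-identityˡ _) (zeroʳ _))

    pathTerm-zero : ∀ x h → pathTerm q x h 0 ≈ 1#
    pathTerm-zero x h = solve 0 (con (1 , 0) :* (con (1 , 0) :* con (1 , 0)) := con (1 , 0)) refl

    -- Pascal's rule produces two summands. The factor q^(m+1) of one turns x into x q; in the
    -- other, m(m+1) = 2m + m(m-1) frees a factor (q²)^m, which turns x into x q². These are exactly
    -- the shifts of the weights `x * q ^ k` by one and by two.
    pathTerm-suc : ∀ x h m → pathTerm q x (suc (suc h)) (suc m) ≈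
      pathTerm q (x * q) (suc h) (suc m) + - x * pathTerm q (x * (q * q)) h m
    pathTerm-suc x h m = begin
      (- x) ^ suc m * (q ^ (suc m ℕ.* m) * g (suc h ∸ m) (suc m))
        ≈⟨ *-congˡ (*-congˡ (gauss-pascal-∸ h m)) ⟩
      (- x) ^ suc m * (q ^ (suc m ℕ.* m) * (g (h ∸ m) m + q ^ suc m * g (h ∸ m) (suc m)))
        ≈⟨ solve 6 (λ a b d e f k → (a :* b) :* (d :* (e :+ f :* k)) :=
             ((a :* b) :* f) :* (d :* k) :+ a :* (b :* (d :* e))) refl (- x) ((- x) ^ m) _ _ _ _ ⟩
      ((- x) ^ suc m * q ^ suc m) * (q ^ (suc m ℕ.* m) * g (h ∸ m) (suc m)) +
        - x * ((- x) ^ m * (q ^ (suc m ℕ.* m) * g (h ∸ m) m))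
        ≈⟨ +-cong (*-congʳ (trans (sym (^-distrib-* (- x) q (suc m))) (^-congˡ (suc m) (neg-* x q))))
                  (*-congˡ rescale) ⟩
      pathTerm q (x * q) (suc h) (suc m) + - x * pathTerm q (x * (q * q)) h m ∎
      where
      neg-* : ∀ x y → - x * y ≈ - (x * y)
      neg-* = solve 2 (λ x y → (:- x) :* y := :- (x :* y)) refl

      square-power : ∀ m → (q * q) ^ m * q ^ (m ℕ.* (m ∸ 1)) ≈ q ^ (suc m ℕ.* m)
      square-power zero    = *-identityˡ 1#
      square-power (suc k) = begin
        (q * q) ^ suc k * q ^ (suc k ℕ.* k)            ≈⟨ *-congʳ (^-distrib-* q q (suc k)) ⟩
        (q ^ suc k * q ^ suc k) * q ^ (suc k ℕ.* k)    ≈⟨ *-congʳ (^-homo-* q (suc k) (suc k)) ⟨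
        q ^ (suc k ℕ.+ suc k) * q ^ (suc k ℕ.* k)      ≈⟨ ^-homo-* q (suc k ℕ.+ suc k) (suc k ℕ.* k) ⟨
        q ^ (suc k ℕ.+ suc k ℕ.+ suc k ℕ.* k)          ≡⟨ ≡.cong (q ^_) (exponent k) ⟩
        q ^ (suc (suc k) ℕ.* suc k)                    ∎
        where
        exponent : ∀ k → suc k ℕ.+ suc k ℕ.+ suc k ℕ.* k ≡.≡ suc (suc k) ℕ.* suc k
        exponent = ℕ-Tactic.solve-∀

      rescale : (- x) ^ m * (q ^ (suc m ℕ.* m) * g (h ∸ m) m) ≈ pathTerm q (x * (q * q)) h m
      rescale = begin
        (- x) ^ m * (q ^ (suc m ℕ.* m) * g (h ∸ m) m)
          ≈⟨ *-congˡ (*-congʳ (square-power m)) ⟨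
        (- x) ^ m * (((q * q) ^ m * q ^ (m ℕ.* (m ∸ 1))) * g (h ∸ m) m)
          ≈⟨ solve 4 (λ a b d e → a :* ((b :* d) :* e) := (a :* b) :* (d :* e)) refl _ _ _ _ ⟩
        ((- x) ^ m * (q * q) ^ m) * (q ^ (m ℕ.* (m ∸ 1)) * g (h ∸ m) m)
          ≈⟨ *-congʳ (trans (sym (^-distrib-* (- x) (q * q) m)) (^-congˡ m (neg-* x (q * q)))) ⟩
        pathTerm q (x * (q * q)) h m ∎

    private
      pathTerm-vanishes : ∀ x h m → h ≤ℕ 1 → pathTerm q x h (suc m) ≈ 0#
      pathTerm-vanishes x h m h≤1 rewrite ℕₚ.m≤n⇒m∸n≡0 {h} {suc m} (ℕₚ.≤-trans h≤1 (s≤s z≤n)) =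
        trans (*-congˡ (zeroʳ _)) (zeroʳ _)

      sum-base : ∀ x h N → h ≤ℕ 1 → sum {suc N} (pathTerm q x h ∘ toℕ) ≈ 1#
      sum-base x h N h≤1 = trans (+-cong (pathTerm-zero x h)
        (trans (sum-cong-≋ {N} λ i → pathTerm-vanishes x h (toℕ i) h≤1) (sum-replicate-zero N)))
        (+-identityʳ 1#)

    -- The number N of terms is left free because the recursion asks for the sum at `suc h` with
    -- `suc N` terms, which can be one more than its natural range. The surplus terms vanish, and
    -- this has to be checked only at h = 0 and h = 1.
    sum-pathTerm : ∀ x h N → ⌊ h /2⌋ <ℕ N →
      sum {N} (pathTerm q x h ∘ toℕ) ≈ continuant (λ k → x * q ^ k) h
    sum-pathTerm x zero          (suc N) _         = sum-base x 0 N z≤n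
    sum-pathTerm x (suc zero)    (suc N) _         = sum-base x 1 N (s≤s z≤n)
    sum-pathTerm x (suc (suc h)) (suc N) (s≤s h<N) = begin
      pathTerm q x (suc (suc h)) 0 + sum {N} (λ i → pathTerm q x (suc (suc h)) (suc (toℕ i)))
        ≈⟨ +-cong (trans (pathTerm-zero x (suc (suc h))) (sym (pathTerm-zero (x * q) (suc h))))
             (trans (sum-cong-≋ {N} λ i → pathTerm-suc x h (toℕ i)) (∑-distrib-+ {N} _ _)) ⟩
      pathTerm q (x * q) (suc h) 0 +
        (sum {N} (λ i → pathTerm q (x * q) (suc h) (suc (toℕ i))) +
         sum {N} (λ i → - x * pathTerm q (x * (q * q)) h (toℕ i)))
        ≈⟨ +-congˡ (+-congˡ (*-distribˡ-sum {N} (- x) _)) ⟨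
      pathTerm q (x * q) (suc h) 0 +
        (sum {N} (λ i → pathTerm q (x * q) (suc h) (suc (toℕ i))) +
         - x * sum {N} (pathTerm q (x * (q * q)) h ∘ toℕ))
        ≈⟨ +-assoc _ _ _ ⟨
      sum {suc N} (pathTerm q (x * q) (suc h) ∘ toℕ) + - x * sum {N} (pathTerm q (x * (q * q)) h ∘ toℕ)
        ≈⟨ +-cong
             (trans (sum-pathTerm (x * q) (suc h) (suc N) (s≤s (ℕₚ.≤-trans (ℕₚ.⌊n/2⌋-mono (ℕₚ.n≤1+n (suc h))) h<N)))
                    (continuant-cong (λ k → *-assoc x q (q ^ k)) (suc h)))
             (*-congˡ (trans (sum-pathTerm (x * (q * q)) h N h<N)
                    (continuant-cong (λ k → trans (*-assoc x _ _) (*-congˡ (*-assoc q q _))) h))) ⟩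
      continuant (λ k → x * q ^ suc k) (suc h) + - x * continuant (λ k → x * q ^ suc (suc k)) h
        ≈⟨ solve 3 (λ x a b → a :+ (:- x) :* b := a :- (x :* con (1 , 0)) :* b) refl x _ _ ⟩
      continuant (λ k → x * q ^ k) (suc (suc h)) ∎

-- The path polynomial as a continuant of polynomials

module PathPolynomial (R : CommutativeRing c ℓ) where
  open CommutativeRing R hiding (zero)
  open Polynomials rawRing
  open PolynomialRing R
  private
    module Q = CommutativeRing polynomialRing
    module Q^ = Algebra.Definitions.RawSemiring (RawRing.rawSemiring polyRing)
  open Algebra.Definitions.RawSemiring (RawRing.rawSemiring rawRing) using (_^_)
  open Algebra.Properties.Semiring.Sum Q.semiring using (sum; sum-cong-≋)
  open Homomorphisms R polynomialRing
  open RingMorphisms.IsRingHomomorphism const-homomorphism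
  open Continuants polynomialRing

  -- The summation result is applied inside the polynomial ring, at `const q` and the indeterminate.
  -- `pathPoly` computes its q-coefficients in R before embedding them, so `const` must first be
  -- moved inside powers and Gaussian binomials.
  pathPoly-continuant : ∀ q h →
    pathPoly rawRing q h ≈ₚ continuant (λ k → indet *ₚ const (q ^ k)) h
  pathPoly-continuant q h = begin
    pathPoly rawRing q h
      ≈⟨ sum-cong-≋ {suc ⌊ h /2⌋} {gaussTerm ∘ toℕ} {pathTerm (const q) indet h ∘ toℕ} (term ∘ toℕ) ⟩
    sum {suc ⌊ h /2⌋} (pathTerm (const q) indet h ∘ toℕ)
      ≈⟨ sum-pathTerm (const q) indet h (suc ⌊ h /2⌋) ℕₚ.≤-refl ⟩
    continuant (λ k → indet *ₚ const q Q^.^ k) h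
      ≈⟨ continuant-cong {λ k → indet *ₚ const (q ^ k)} {λ k → indet *ₚ const q Q^.^ k}
           (λ k → Q.*-congˡ {indet} {const (q ^ k)} {const q Q^.^ k} (^-homo const-homomorphism q k)) h ⟨
    continuant (λ k → indet *ₚ const (q ^ k)) h ∎
    where
    open PathSum polynomialRing using (pathTerm; sum-pathTerm)
    open Relation.Binary.Reasoning.Setoid Q.setoid
    gaussTerm : ℕ → Poly
    gaussTerm m = (map (-_) indet Q^.^ m) *ₚ const (q ^ (m ℕ.* (m ∸ 1)) * gauss rawRing q (h ∸ m) m)
    term : ∀ m → gaussTerm m ≈ₚ pathTerm (const q) indet h m
    term m = Q.*-congˡ {map (-_) indet Q^.^ m} {const (q ^ e * G)} {(const q Q^.^ e) *ₚ G′} (begin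
      const (q ^ e * G)            ≈⟨ *-homo (q ^ e) G ⟩
      const (q ^ e) *ₚ const G     ≈⟨ Q.*-cong {const (q ^ e)} {const q Q^.^ e} {const G} {G′}
                                        (^-homo const-homomorphism q e)
                                        (gauss-homo const-homomorphism q (h ∸ m) m) ⟩
      (const q Q^.^ e) *ₚ G′       ∎)
      where
      e = m ℕ.* (m ∸ 1)
      G = gauss rawRing q (h ∸ m) m
      G′ = gauss polyRing (const q) (h ∸ m) m

-- Values of the path polynomial

module PathPolynomialValues (R : CommutativeRing c ℓ) (S : CommutativeRing c′ ℓ′)
  {ι : CommutativeRing.Carrier R → CommutativeRing.Carrier S}
  (hom : Homomorphisms.IsRingHomomorphism R S ι) where
  private
    module R = CommutativeRing R
  open CommutativeRing S hiding (zero)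
  open Continuants S
  open PolynomialRing R using (polynomialRing)
  open Polynomials R.rawRing using (_*ₚ_; indet; const; eval)
  open Algebra.Definitions.RawSemiring (RawRing.rawSemiring R.rawRing) using (_^_)

  -- Used for three targets: substitution of T² in the polynomial ring, real values, and complex
  -- values.
  eval-pathPoly : ∀ q h x → eval rawRing ι x (pathPoly R.rawRing q h) ≈ continuant (λ k → x * ι (q ^ k)) h
  eval-pathPoly q h x =
    trans (⟦⟧-cong {pathPoly R.rawRing q h}
        {Continuants.continuant polynomialRing (λ k → indet *ₚ const (q ^ k)) h}
      (PathPolynomial.pathPoly-continuant R q h))
    (trans (continuant-homo (λ k → indet *ₚ const (q ^ k)) h)
    (continuant-cong (λ k → trans (*-homo indet (const (q ^ k))) (*-cong eval-indet (eval-const (q ^ k)))) h))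
    where
    open Evaluation R S hom x
    open ContinuantHomomorphism polynomialRing S eval-homomorphism
    open RingMorphisms.IsRingHomomorphism eval-homomorphism

-- Determinants of I - tM for zero-diagonal tridiagonal M

module JacobiDeterminant (R : CommutativeRing c ℓ) where
  open CommutativeRing R hiding (zero)
  open Matrices rawRing
  open Continuants R
  open Determinants R
  open RingSolver R
  open Algebra.Definitions.RawSemiring (RawRing.rawSemiring rawRing) using (_^_)

  record IsJacobi (e : ℕ → ℕ → Carrier) (w : ℕ → Carrier) : Set ℓ where
    field
      diagonal : ∀ i → e i i ≈ 0#
      adjacent : ∀ i → e i (suc i) * e (suc i) i ≈ w i
      above    : ∀ i j → e i (suc (suc (i ℕ.+ j))) ≈ 0#
      below    : ∀ i j → e (suc (suc (i ℕ.+ j))) i ≈ 0#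

  private
    -- The identity matrix on ℕ, so that `1ₘ` too becomes a corner of an infinite matrix.
    δ : ℕ → ℕ → Carrier
    δ i j with i ℕ.≟ j
    ... | yes _ = 1#
    ... | no _  = 0#

    δ-diagonal : ∀ i → δ i i ≈ 1#
    δ-diagonal i with i ℕ.≟ i
    ... | yes _ = refl
    ... | no ≢  = ⊥-elim (≢ ≡.refl)

    δ-off : ∀ {i j} → i ≡.≢ j → δ i j ≈ 0#
    δ-off {i} {j} p with i ℕ.≟ j
    ... | yes e = ⊥-elim (p e)
    ... | no _  = refl

    1ₘ-δ : ∀ {n} (i j : Fin n) → 1ₘ i j ≈ δ (toℕ i) (toℕ j)
    1ₘ-δ i j with i Fin.≟ j
    ... | yes ≡.refl = sym (δ-diagonal (toℕ i))
    ... | no i≢j     = sym (δ-off (i≢j ∘ Finₚ.toℕ-injective))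

    minus-zero : ∀ {d d′ a} t → d ≈ d′ → a ≈ 0# → d - t * a ≈ d′
    minus-zero {d′ = d′} t p q = trans (-‿cong₂ p (*-congˡ q))
      (solve 2 (λ d t → d :- t :* con (0 , 0) := d) refl d′ t)

  -- Off-diagonal entries enter only as products of opposite pairs, and both members of a pair carry
  -- the factor - t. Hence only t² survives, which is the independence of the branch of √X.
  det-jacobi : ∀ {e w} → IsJacobi e w → ∀ t n {M : Matrix n} →
    (∀ i j → M i j ≈ e (toℕ i) (toℕ j)) → det (1ₘ -ₘ t ·ₘ M) ≈ continuant (λ k → t ^ 2 * w k) n
  det-jacobi {e} {w} J t n {M} M≈e = trans
    (det-cong λ i j → -‿cong₂ (1ₘ-δ i j) (*-congˡ (M≈e i j)))
    (det-continuant tridiagonal n)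
    where
    open IsJacobi J
    i<2+i+j : ∀ i j → i <ℕ suc (suc (i ℕ.+ j))
    i<2+i+j i j = s≤s (ℕₚ.m≤n⇒m≤1+n (ℕₚ.m≤m+n i j))
    tridiagonal : IsUnitTridiagonal (λ i j → δ i j - t * e i j) (λ k → t ^ 2 * w k)
    tridiagonal = record
      { diagonal = λ i → minus-zero t (δ-diagonal i) (diagonal i)
      ; adjacent = λ i → trans
          (*-cong (-‿cong₂ (δ-off (ℕₚ.<⇒≢ (ℕₚ.n<1+n i))) refl)
                  (-‿cong₂ (δ-off (ℕₚ.1+n≢n {i})) refl))
          (trans (solve 3 (λ t x y → (con (0 , 0) :- t :* x) :* (con (0 , 0) :- t :* y) :=
                                     (t :* (t :* con (1 , 0))) :* (x :* y)) refl t _ _)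
                 (*-congˡ (adjacent i)))
      ; above    = λ i j → minus-zero t (δ-off (ℕₚ.<⇒≢ (i<2+i+j i j))) (above i j)
      ; below    = λ i j → minus-zero t (δ-off (ℕₚ.>⇒≢ (i<2+i+j i j))) (below i j)
      }

-- The determinant formula for the path matrix

module PathMatrix {ℓ} (𝓡 : RealNumbers ℓ) where
  open Reals 𝓡 hiding (zero)
  open PolynomialRing commutativeRing using (polynomialRing; const-homomorphism)
  private
    module Q = CommutativeRing polynomialRing
    module Q^ = Algebra.Definitions.RawSemiring (RawRing.rawSemiring polyRing)
  open Algebra.Properties.CommutativeSemiring.Exp commutativeSemiring using (^-distrib-*; ^-congˡ)
  open RingMorphisms.IsRingHomomorphism const-homomorphism
  open Continuants polynomialRing

  module _ {r : ℝ} (0<r : 0# < r) where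
    s : ℝ
    s = √ (inj₁ 0<r)

    pathEntry : ℕ → ℕ → ℝ
    pathEntry i j with j ℕ.≟ suc i | i ℕ.≟ suc j
    ... | yes _ | _     = s ^ i
    ... | no _  | yes _ = s ^ j
    ... | no _  | no _  = 0#

    A-pathEntry : ∀ h i j → A h 0<r i j ≡.≡ pathEntry (toℕ i) (toℕ j)
    A-pathEntry h i j with toℕ j ℕ.≟ suc (toℕ i) | toℕ i ℕ.≟ suc (toℕ j)
    ... | yes _ | _     = ≡.refl
    ... | no _  | yes _ = ≡.refl
    ... | no _  | no _  = ≡.refl

    pathEntry-above : ∀ i → pathEntry i (suc i) ≡.≡ s ^ i
    pathEntry-above i with suc i ℕ.≟ suc i | i ℕ.≟ suc (suc i)
    ... | yes _ | _ = ≡.refl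
    ... | no ≢  | _ = ⊥-elim (≢ ≡.refl)

    pathEntry-below : ∀ i → pathEntry (suc i) i ≡.≡ s ^ i
    pathEntry-below i with i ℕ.≟ suc (suc i) | suc i ℕ.≟ suc i
    ... | yes () | _
    ... | no _   | yes _ = ≡.refl
    ... | no _   | no ≢  = ⊥-elim (≢ ≡.refl)

    pathEntry-nonadjacent : ∀ {i j} → j ≡.≢ suc i → i ≡.≢ suc j → pathEntry i j ≡.≡ 0#
    pathEntry-nonadjacent {i} {j} p q with j ℕ.≟ suc i | i ℕ.≟ suc j
    ... | yes e | _     = ⊥-elim (p e)
    ... | no _  | yes e = ⊥-elim (q e)
    ... | no _  | no _  = ≡.refl

    s^-square : ∀ k → s ^ k * s ^ k ≈ r ^ k
    s^-square k = trans (sym (^-distrib-* s s k)) (^-congˡ k (√-square (inj₁ 0<r)))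


    private
      not-next : ∀ k i → suc (suc (i ℕ.+ k)) ≡.≢ suc i
      not-next k i = ℕₚ.m≢1+m+n i ∘ ≡.sym ∘ ℕₚ.suc-injective

      not-previous : ∀ k i → i ≡.≢ suc (suc (suc (i ℕ.+ k)))
      not-previous k i = ℕₚ.<⇒≢ (s≤s (ℕₚ.m≤n⇒m≤1+n (ℕₚ.m≤n⇒m≤1+n (ℕₚ.m≤m+n i k))))

    pathEntry-jacobi : JacobiDeterminant.IsJacobi polynomialRing
      (λ i j → const (pathEntry i j)) (λ k → const (r ^ k))
    pathEntry-jacobi = record
      { diagonal = λ i → const-zero (pathEntry-nonadjacent (ℕₚ.<⇒≢ (ℕₚ.n<1+n i)) (ℕₚ.<⇒≢ (ℕₚ.n<1+n i)))
      ; adjacent = λ i → adjacent i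
      ; above    = λ i j → const-zero (pathEntry-nonadjacent (not-next j i) (not-previous j i))
      ; below    = λ i j → const-zero (pathEntry-nonadjacent (not-previous j i) (not-next j i))
      }
      where
      open Relation.Binary.Reasoning.Setoid Q.setoid
      const-zero : ∀ {a} → a ≡.≡ 0# → const a ≈ₚ Q.0#
      const-zero ≡.refl = 0#-homo
      adjacent : ∀ i → const (pathEntry i (suc i)) Q.* const (pathEntry (suc i) i) ≈ₚ const (r ^ i)
      adjacent i rewrite pathEntry-above i | pathEntry-below i = begin
        const (s ^ i) Q.* const (s ^ i)  ≈⟨ *-homo (s ^ i) (s ^ i) ⟨
        const (s ^ i * s ^ i)            ≈⟨ ⟦⟧-cong (s^-square i) ⟩
        const (r ^ i)                    ∎

    det-path : ∀ h → detI-√X (A h 0<r) ≈ₚ continuant (λ k → indet Q^.^ 2 Q.* const (r ^ k)) h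
    det-path h = JacobiDeterminant.det-jacobi polynomialRing pathEntry-jacobi indet h {mapₘ const (A h 0<r)}
      (λ i j → ⟦⟧-cong (reflexive (A-pathEntry h i j)))

    P-IsInXFor-det : ∀ h → P h r IsInXFor detI-√X (A h 0<r)
    P-IsInXFor-det h = begin
      eval polyRing const (indet Q^.^ 2) (P h r)           ≈⟨ eval-pathPoly r h (indet Q^.^ 2) ⟩
      continuant (λ k → indet Q^.^ 2 Q.* const (r ^ k)) h  ≈⟨ det-path h ⟨
      detI-√X (A h 0<r)                                    ∎
      where
      open Relation.Binary.Reasoning.Setoid Q.setoid
      open PathPolynomialValues commutativeRing polynomialRing const-homomorphism using (eval-pathPoly)

-- Complex numbers as a commutative ring

module ComplexNumbers {ℓ} (𝓡 : RealNumbers ℓ) where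
  open Reals 𝓡 hiding (zero)
  open RingSolver commutativeRing

  complexCommutativeRing : CommutativeRing ℓ ℓ
  complexCommutativeRing = record
    { RawRing complexRing
    ; isCommutativeRing = record
      { isRing = record
        { +-isAbelianGroup = record
          { isGroup = record
            { isMonoid = record
              { isSemigroup = record
                { isMagma = record
                  { isEquivalence = record
                    { refl  = refl , refl
                    ; sym   = λ { (p , q) → sym p , sym q }
                    ; trans = λ { (p , q) (p′ , q′) → trans p p′ , trans q q′ }
                    }
                  ; ∙-cong = λ { (p , q) (p′ , q′) → +-cong p p′ , +-cong q q′ }
                  }
                ; assoc = λ _ _ _ → +-assoc _ _ _ , +-assoc _ _ _
                }
              ; identity = (λ _ → +-identityˡ _ , +-identityˡ _) , λ _ → +-identityʳ _ , +-identityʳ _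
              }
            ; inverse = (λ _ → -‿inverseˡ _ , -‿inverseˡ _) , λ _ → -‿inverseʳ _ , -‿inverseʳ _
            ; ⁻¹-cong = λ { (p , q) → -‿cong p , -‿cong q }
            }
          ; comm = λ _ _ → +-comm _ _ , +-comm _ _
          }
        ; *-cong = λ { (p , q) (p′ , q′) →
            +-cong (*-cong p p′) (-‿cong (*-cong q q′)) , +-cong (*-cong p q′) (*-cong q p′) }
        ; *-assoc = λ { (a , b) (d , e) (x , y) →
            solve 6 (λ a b d e x y →
              (a :* d :- b :* e) :* x :- (a :* e :+ b :* d) :* y :=
              a :* (d :* x :- e :* y) :- b :* (d :* y :+ e :* x)) refl a b d e x y
            , solve 6 (λ a b d e x y →
              (a :* d :- b :* e) :* y :+ (a :* e :+ b :* d) :* x :=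
              a :* (d :* y :+ e :* x) :+ b :* (d :* x :- e :* y)) refl a b d e x y }
        ; *-identity =
            (λ { (a , b) →
              solve 2 (λ a b → con (1 , 0) :* a :- con (0 , 0) :* b := a) refl a b
              , solve 2 (λ a b → con (1 , 0) :* b :+ con (0 , 0) :* a := b) refl a b })
            , (λ { (a , b) →
              solve 2 (λ a b → a :* con (1 , 0) :- b :* con (0 , 0) := a) refl a b
              , solve 2 (λ a b → a :* con (0 , 0) :+ b :* con (1 , 0) := b) refl a b })
        ; distrib =
            (λ { (a , b) (d , e) (x , y) →
              solve 6 (λ a b d e x y → a :* (d :+ x) :- b :* (e :+ y) :=
                (a :* d :- b :* e) :+ (a :* x :- b :* y)) refl a b d e x y
              , solve 6 (λ a b d e x y → a :* (e :+ y) :+ b :* (d :+ x) :=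
                (a :* e :+ b :* d) :+ (a :* y :+ b :* x)) refl a b d e x y })
            , (λ { (a , b) (d , e) (x , y) →
              solve 6 (λ a b d e x y → (d :+ x) :* a :- (e :+ y) :* b :=
                (d :* a :- e :* b) :+ (x :* a :- y :* b)) refl a b d e x y
              , solve 6 (λ a b d e x y → (d :+ x) :* b :+ (e :+ y) :* a :=
                (d :* b :+ e :* a) :+ (x :* b :+ y :* a)) refl a b d e x y })
        }
      ; *-comm = λ { (a , b) (d , e) →
          solve 4 (λ a b d e → a :* d :- b :* e := d :* a :- e :* b) refl a b d e
          , solve 4 (λ a b d e → a :* e :+ b :* d := d :* b :+ e :* a) refl a b d e }
      }
    }

  ofReal-homomorphism : Homomorphisms.IsRingHomomorphism commutativeRing complexCommutativeRing ofReal
  ofReal-homomorphism = Homomorphisms.ringHomomorphism commutativeRing complexCommutativeRing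
    (λ p → p , refl)
    (λ _ _ → refl , sym (+-identityˡ _))
    (λ a b → solve 2 (λ a b → a :* b := a :* b :- con (0 , 0) :* con (0 , 0)) refl a b
           , solve 2 (λ a b → con (0 , 0) := a :* con (0 , 0) :+ con (0 , 0) :* b) refl a b)
    (λ _ → refl , solve 0 (con (0 , 0) := :- con (0 , 0)) refl)
    (refl , refl)
    (refl , refl)

-- Inequalities in the ordered field

module OrderedFieldLemmas {ℓ} (𝓡 : RealNumbers ℓ) where
  open Reals 𝓡 hiding (zero)
  open OrderedField
  open RingSolver commutativeRing

  ≤-resp : ∀ {a b a′ b′} → a ≈ a′ → b ≈ b′ → a ≤ b → a′ ≤ b′
  ≤-resp p q (inj₁ a<b) = inj₁ (resp p q a<b)
  ≤-resp p q (inj₂ a≈b) = inj₂ (trans (sym p) (trans a≈b q))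

  ≮⇒≥ : ∀ {a b} → ¬ (a < b) → b ≤ a
  ≮⇒≥ {a} {b} a≮b with compare a b
  ... | tri< a<b _ _ = ⊥-elim (a≮b a<b)
  ... | tri≈ _ a≈b _ = inj₂ (sym a≈b)
  ... | tri> _ _ b<a = inj₁ b<a

  ≤-<-connex : ∀ a b → a ≤ b ⊎ b < a
  ≤-<-connex a b with compare a b
  ... | tri< a<b _ _ = inj₁ (inj₁ a<b)
  ... | tri≈ _ a≈b _ = inj₁ (inj₂ a≈b)
  ... | tri> _ _ b<a = inj₂ b<a

  0<b-a : ∀ {a b} → a < b → 0# < b - a
  0<b-a {a} a<b = resp (-‿inverseʳ a) refl (+-monoˡ-< (- a) a<b)

  0≤b-a : ∀ {a b} → a ≤ b → 0# ≤ b - a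
  0≤b-a     (inj₁ a<b) = inj₁ (0<b-a a<b)
  0≤b-a {a} (inj₂ a≈b) = inj₂ (sym (trans (+-congʳ (sym a≈b)) (-‿inverseʳ a)))

  a-b+b : ∀ a b → (a - b) + b ≈ a
  a-b+b = solve 2 (λ a b → (a :- b) :+ b := a) refl

  0<b-a⇒a<b : ∀ {a b} → 0# < b - a → a < b
  0<b-a⇒a<b {a} {b} p = resp (+-identityˡ a) (a-b+b b a) (+-monoˡ-< a p)

  0≤b-a⇒a≤b : ∀ {a b} → 0# ≤ b - a → a ≤ b
  0≤b-a⇒a≤b         (inj₁ p) = inj₁ (0<b-a⇒a<b p)
  0≤b-a⇒a≤b {a} {b} (inj₂ p) = inj₂ (trans (sym (+-identityˡ a)) (trans (+-congʳ p) (a-b+b b a)))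

  0<+0≤ : ∀ {a b} → 0# < a → 0# ≤ b → 0# < a + b
  0<+0≤ 0<a 0≤b = <-respʳ-≈ (+-comm _ _) (0≤+0< 0≤b 0<a)

  *-monoˡ-≤ : ∀ {a b d} → 0# ≤ d → a ≤ b → d * a ≤ d * b
  *-monoˡ-≤ {a} {b} {d} 0≤d a≤b = 0≤b-a⇒a≤b (≤-resp refl
    (solve 3 (λ a b d → d :* (b :- a) := d :* b :- d :* a) refl a b d) (0≤*0≤ 0≤d (0≤b-a a≤b)))

  *-monoʳ-≤ : ∀ {a b d} → 0# ≤ d → a ≤ b → a * d ≤ b * d
  *-monoʳ-≤ 0≤d a≤b = ≤-resp (*-comm _ _) (*-comm _ _) (*-monoˡ-≤ 0≤d a≤b)

  +-mono-≤ : ∀ {a b d e} → a ≤ b → d ≤ e → a + d ≤ b + e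
  +-mono-≤ {a} {b} {d} {e} a≤b d≤e = 0≤b-a⇒a≤b (≤-resp refl
    (solve 4 (λ a b d e → (b :- a) :+ (e :- d) := (b :+ e) :- (a :+ d)) refl a b d e)
    (0≤+0≤ (0≤b-a a≤b) (0≤b-a d≤e)))

  ≤-antisym : ∀ {a b} → a ≤ b → b ≤ a → a ≈ b
  ≤-antisym (inj₂ a≈b) _   = a≈b
  ≤-antisym (inj₁ a<b) b≤a = ⊥-elim (<⇒≱ a<b b≤a)

  ≤-trans : ∀ {a b d} → a ≤ b → b ≤ d → a ≤ d
  ≤-trans (inj₁ a<b) b≤d = inj₁ (<-≤-trans a<b b≤d)
  ≤-trans (inj₂ a≈b) b≤d = ≤-resp (sym a≈b) refl b≤d

  0<a² : ∀ {a} → a ≉ 0# → 0# < a * a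
  0<a² {a} a≉0 with compare 0# a
  ... | tri< 0<a _ _ = *-pos 0<a 0<a
  ... | tri≈ _ 0≈a _ = ⊥-elim (a≉0 (sym 0≈a))
  ... | tri> _ _ a<0 = <-respʳ-≈ (solve 1 (λ a → (:- a) :* (:- a) := a :* a) refl a)
                         (*-pos (<0⇒0<- a<0) (<0⇒0<- a<0))

  sq-≤-cancel : ∀ {a b} → 0# ≤ b → a * a ≤ b * b → a ≤ b
  sq-≤-cancel 0≤b p = ≮⇒≥ λ b<a → <⇒≱ (sq-mono 0≤b b<a) p

  sq-injective : ∀ {a b} → 0# ≤ a → 0# ≤ b → a * a ≈ b * b → a ≈ b
  sq-injective 0≤a 0≤b p =
    ≤-antisym (sq-≤-cancel 0≤b (inj₂ p)) (sq-≤-cancel 0≤a (inj₂ (sym p)))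

  <⇒≉ : ∀ {a} → 0# < a → a ≉ 0#
  <⇒≉ 0<a a≈0 = <-irrefl (sym a≈0) 0<a

  inverse-* : ∀ {x} (x≉0 : x ≉ 0#) → inverse x≉0 * x ≈ 1#
  inverse-* x≉0 = proj₁ (proj₂ (invertible x≉0))

  0<^ : ∀ {r} → 0# < r → ∀ k → 0# < r ^ k
  0<^ 0<r zero    = 0<1
  0<^ 0<r (suc k) = *-pos 0<r (0<^ 0<r k)

-- Zeros are real and positive

module ComplexZeros {ℓ} (𝓡 : RealNumbers ℓ) {r} (0<r : RealNumbers._<_ 𝓡 (RealNumbers.0# 𝓡) r) where
  open Reals 𝓡 hiding (zero)
  open OrderedField
  open OrderedFieldLemmas 𝓡
  open ComplexNumbers 𝓡
  open RingSolver commutativeRing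
  open Continuants commutativeRing
  private
    module ℂ = CommutativeRing complexCommutativeRing
    module Cℂ = Continuants complexCommutativeRing

  K : ℝ → ℕ → ℝ
  K x = continuant (λ k → x * r ^ k)

  Kᶜ : ℂ → ℕ → ℂ
  Kᶜ z = Cℂ.continuant (λ k → z ℂ.* ofReal (r ^ k))

  K-cong : ∀ {x y} → x ≈ y → ∀ h → K x h ≈ K y h
  K-cong p = continuant-cong (λ k → *-congʳ p)

  Kᶜ-ofReal : ∀ {z} → Im z ≈ 0# → ∀ h → Kᶜ z h ≈ᶜ ofReal (K (Re z) h)
  Kᶜ-ofReal {z} Im≈0 h = ℂ.sym {ofReal (K x h)} {Kᶜ z h}
    (ℂ.trans {ofReal (K x h)} {Cℂ.continuant (λ k → ofReal (x * r ^ k)) h} {Kᶜ z h}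
      (continuant-homo _ h)
      (Cℂ.continuant-cong {λ k → ofReal (x * r ^ k)} {λ k → z ℂ.* ofReal (r ^ k)}
        (λ k → ℂ.trans {ofReal (x * r ^ k)} {ofReal x ℂ.* ofReal (r ^ k)} {z ℂ.* ofReal (r ^ k)}
          (*-homo x (r ^ k))
          (ℂ.*-congʳ {ofReal (r ^ k)} {ofReal x} {z} (refl , sym Im≈0))) h))
    where
    x = Re z
    open ContinuantHomomorphism commutativeRing complexCommutativeRing ofReal-homomorphism
    open RingMorphisms.IsRingHomomorphism ofReal-homomorphism

  K-positive : ∀ {x} → x ≤ 0# → ∀ h → 0# < K x h
  K-positive {x} x≤0 h = proj₁ (go h)
    where
    0≤-x : 0# ≤ - x
    0≤-x = ≤-resp refl (+-identityˡ _) (0≤b-a x≤0)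
    go : ∀ h → 0# < K x h × 0# < K x (suc h)
    go zero    = 0<1 , 0<1
    go (suc h) = proj₂ (go h) , <-respʳ-≈ eq
      (0<+0≤ (proj₂ (go h)) (0≤*0≤ (0≤*0≤ 0≤-x (inj₁ (0<^ 0<r h))) (inj₁ (proj₁ (go h)))))
      where
      eq : K x (suc h) + (- x * r ^ h) * K x h ≈ K x (suc (suc h))
      eq = trans (solve 4 (λ k x p k′ → k :+ ((:- x) :* p) :* k′ := k :- (x :* p) :* k′) refl _ x _ _)
                 (sym (continuant-last _ h))

  -- For u_k = Kᶜ z k, the two quantities are Im z · Im (u_k conj u_{k+1}) and
  -- Im z · Im (z u_k conj u_{k+1}); the recurrence u_{k+2} = u_{k+1} - z r^k u_k
  -- makes the first one at k+1 equal to r^k times the second one at k, and the second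
  -- one at k+1 equal to (Im z)²|u_{k+1}|² plus |z|² r^k times the first one at k.
  module _ (z : ℂ) (Im≉0 : Im z ≉ 0#) where
    private
      a = Re z
      b = Im z

      cross dot : ℂ → ℂ → ℝ
      cross (x , y) (x′ , y′) = y * x′ - x * y′
      dot   (x , y) (x′ , y′) = x * x′ + y * y′

      twist : ℂ → ℂ → ℝ
      twist u u′ = a * cross u u′ + b * dot u u′

      -- The first inequality must be weak, since u_0 = u_1 = 1 has `cross` equal to zero. The
      -- strict one excludes zeros because `twist` is linear over ℝ in each argument.
      NonvanishingPair : ℂ → ℂ → Set ℓ
      NonvanishingPair u u′ = 0# ≤ b * cross u u′ × 0# < b * twist u u′

      step : ∀ p → 0# < p → ∀ u u′ u″ → u″ ≈ᶜ (u′ ℂ.- (z ℂ.* ofReal p) ℂ.* u) →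
        NonvanishingPair u u′ → NonvanishingPair u′ u″
      step p 0<p (x , y) (x′ , y′) (x″ , y″) (ex , ey) (0≤cross , 0<twist) =
        ≤-resp refl (sym cross-eq) (0≤*0≤ (inj₁ 0<p) (inj₁ 0<twist)) ,
        <-respʳ-≈ (sym twist-eq) (0<+0≤ (*-pos (0<a² Im≉0) 0<norm)
          (0≤*0≤ (0≤*0≤ (0≤+0≤ (0≤a² a) (0≤a² b)) (inj₁ 0<p)) 0≤cross))
        where
        cross-eq : b * (y′ * x″ - x′ * y″) ≈ p * (b * (a * (y * x′ - x * y′) + b * (x * x′ + y * y′)))
        cross-eq = trans (*-congˡ (-‿cong₂ (*-congˡ ex) (*-congˡ ey)))
          (solve 7 (λ a b p x y x′ y′ →
            let X = x′ :- ((a :* p :- b :* con (0 , 0)) :* x :- (a :* con (0 , 0) :+ b :* p) :* y)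
                Y = y′ :- ((a :* p :- b :* con (0 , 0)) :* y :+ (a :* con (0 , 0) :+ b :* p) :* x)
            in b :* (y′ :* X :- x′ :* Y) :=
               p :* (b :* (a :* (y :* x′ :- x :* y′) :+ b :* (x :* x′ :+ y :* y′)))) refl a b p x y x′ y′)

        twist-eq : b * (a * (y′ * x″ - x′ * y″) + b * (x′ * x″ + y′ * y″)) ≈
          (b * b) * (x′ * x′ + y′ * y′) + ((a * a + b * b) * p) * (b * (y * x′ - x * y′))
        twist-eq = trans (*-congˡ (+-cong (*-congˡ (-‿cong₂ (*-congˡ ex) (*-congˡ ey)))
                                          (*-congˡ (+-cong (*-congˡ ex) (*-congˡ ey)))))
          (solve 7 (λ a b p x y x′ y′ →
            let X = x′ :- ((a :* p :- b :* con (0 , 0)) :* x :- (a :* con (0 , 0) :+ b :* p) :* y)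
                Y = y′ :- ((a :* p :- b :* con (0 , 0)) :* y :+ (a :* con (0 , 0) :+ b :* p) :* x)
            in b :* (a :* (y′ :* X :- x′ :* Y) :+ b :* (x′ :* X :+ y′ :* Y)) :=
               (b :* b) :* (x′ :* x′ :+ y′ :* y′) :+
               ((a :* a :+ b :* b) :* p) :* (b :* (y :* x′ :- x :* y′))) refl a b p x y x′ y′)

        -- The hypothesis `0<twist` already forces u′ ≠ 0: with u′ = 0 the twist would vanish. This
        -- is what keeps the new twist strictly positive.
        0<norm : 0# < x′ * x′ + y′ * y′
        0<norm with compare x′ 0# | compare y′ 0#
        ... | tri< _ x≉0 _ | _            = 0<+0≤ (0<a² x≉0) (0≤a² y′)
        ... | tri> _ x≉0 _ | _            = 0<+0≤ (0<a² x≉0) (0≤a² y′)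
        ... | tri≈ _ x≈0 _ | tri< _ y≉0 _ = 0≤+0< (0≤a² x′) (0<a² y≉0)
        ... | tri≈ _ x≈0 _ | tri> _ y≉0 _ = 0≤+0< (0≤a² x′) (0<a² y≉0)
        ... | tri≈ _ x≈0 _ | tri≈ _ y≈0 _ = ⊥-elim (<-irrefl (sym twist≈0) 0<twist)
          where
          twist≈0 : b * (a * (y * x′ - x * y′) + b * (x * x′ + y * y′)) ≈ 0#
          twist≈0 = trans
            (*-congˡ (+-cong (*-congˡ (-‿cong₂ (*-congˡ x≈0) (*-congˡ y≈0)))
                             (*-congˡ (+-cong (*-congˡ x≈0) (*-congˡ y≈0)))))
            (solve 4 (λ a b x y → b :* (a :* (y :* con (0 , 0) :- x :* con (0 , 0)) :+
                                        b :* (x :* con (0 , 0) :+ y :* con (0 , 0))) := con (0 , 0))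
              refl a b x y)

      nonvanishing : ∀ k → NonvanishingPair (Kᶜ z k) (Kᶜ z (suc k))
      nonvanishing zero    =
        inj₂ (solve 1 (λ b → con (0 , 0) :=
            b :* (con (0 , 0) :* con (1 , 0) :- con (1 , 0) :* con (0 , 0))) refl b) ,
        <-respʳ-≈ (solve 2 (λ a b → b :* b :=
            b :* (a :* (con (0 , 0) :* con (1 , 0) :- con (1 , 0) :* con (0 , 0)) :+
                  b :* (con (1 , 0) :* con (1 , 0) :+ con (0 , 0) :* con (0 , 0)))) refl a b) (0<a² Im≉0)
      nonvanishing (suc k) = step (r ^ k) (0<^ 0<r k) (Kᶜ z k) (Kᶜ z (suc k)) (Kᶜ z (suc (suc k)))
        (Cℂ.continuant-last (λ k → z ℂ.* ofReal (r ^ k)) k) (nonvanishing k)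

    Kᶜ-nonreal : ∀ h → ¬ (Kᶜ z h ≈ᶜ 0ᶜ)
    Kᶜ-nonreal h (x≈0 , y≈0) = <-irrefl (sym twist≈0) (proj₂ (nonvanishing h))
      where
      twist≈0 : b * twist (Kᶜ z h) (Kᶜ z (suc h)) ≈ 0#
      twist≈0 = trans
        (*-congˡ (+-cong (*-congˡ (-‿cong₂ (*-congʳ y≈0) (*-congʳ x≈0)))
                         (*-congˡ (+-cong (*-congʳ x≈0) (*-congʳ y≈0)))))
        (solve 4 (λ a b x y → b :* (a :* (con (0 , 0) :* x :- con (0 , 0) :* y) :+
                                    b :* (con (0 , 0) :* x :+ con (0 , 0) :* y)) := con (0 , 0))
          refl a b _ _)

  Kᶜ-zeros-positive : ∀ z h → Kᶜ z h ≈ᶜ 0ᶜ → Im z ≈ 0# × 0# < Re z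
  Kᶜ-zeros-positive z h K≈0 with compare (Im z) 0#
  ... | tri< _ Im≉0 _ = ⊥-elim (Kᶜ-nonreal z Im≉0 h K≈0)
  ... | tri> _ Im≉0 _ = ⊥-elim (Kᶜ-nonreal z Im≉0 h K≈0)
  ... | tri≈ _ Im≈0 _ with ≤-<-connex (Re z) 0#
  ...   | inj₂ 0<Re = Im≈0 , 0<Re
  ...   | inj₁ Re≤0 = ⊥-elim (<⇒≉ (K-positive Re≤0 h) (trans (sym (proj₁ (Kᶜ-ofReal Im≈0 h))) (proj₁ K≈0)))

-- Lipschitz bounds and the first zero of a function

module FirstZeros {ℓ} (𝓡 : RealNumbers ℓ) where
  open Reals 𝓡 hiding (zero)
  open OrderedField
  open OrderedFieldLemmas 𝓡
  open RingSolver commutativeRing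

  -- A quantitative substitute for continuity: the constant can be computed along Horner's scheme
  -- and yields explicit step sizes. The two one-sided inequalities stand for an absolute value.
  IsLipschitzOn : ℝ → (ℝ → ℝ) → ℝ → Set ℓ
  IsLipschitzOn b f L = ∀ x y → 0# ≤ x → x ≤ y → y ≤ b →
    f y - f x ≤ L * (y - x) × f x - f y ≤ L * (y - x)

  private
    abs-bound : ∀ a → ∃ λ M → 0# ≤ M × a ≤ M × - a ≤ M
    abs-bound a with ≤-<-connex 0# a
    ... | inj₁ 0≤a = a , 0≤a , inj₂ refl ,
      ≤-trans (≤-resp (+-identityˡ _) (-‿inverseʳ a) (+-mono-≤ 0≤a (inj₂ refl))) 0≤a
    ... | inj₂ a<0 = - a , inj₁ (<0⇒0<- a<0) , inj₁ (<-trans a<0 (<0⇒0<- a<0)) , inj₂ refl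

    evalℝ : ℝ → Poly → ℝ
    evalℝ = eval rawRing (λ a → a)

    neg-horner : ∀ a x u → - a + x * - u ≈ - (a + x * u)
    neg-horner = solve 3 (λ a x u → :- a :+ x :* (:- u) := :- (a :+ x :* u)) refl

  module _ {b : ℝ} (0≤b : 0# ≤ b) where
    polynomial-bounded : ∀ p → ∃ λ M → 0# ≤ M ×
      (∀ x → 0# ≤ x → x ≤ b → evalℝ x p ≤ M × - evalℝ x p ≤ M)
    polynomial-bounded []      = 0# , inj₂ refl , λ _ _ _ →
      inj₂ refl , inj₂ (trans (sym (+-identityˡ _)) (-‿inverseʳ 0#))
    polynomial-bounded (a ∷ p) with abs-bound a | polynomial-bounded p
    ... | N , 0≤N , a≤N , -a≤N | M , 0≤M , bound =
      N + b * M , 0≤+0≤ 0≤N (0≤*0≤ 0≤b 0≤M) , λ x 0≤x x≤b →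
        let scaled : ∀ {y} → y ≤ M → x * y ≤ b * M
            scaled y≤M = ≤-trans (*-monoˡ-≤ 0≤x y≤M) (*-monoʳ-≤ 0≤M x≤b)
        in +-mono-≤ a≤N (scaled (proj₁ (bound x 0≤x x≤b))) ,
           ≤-resp (neg-horner a x _) refl (+-mono-≤ -a≤N (scaled (proj₂ (bound x 0≤x x≤b))))

    private
      product-slope : ∀ {x y g h M q} → 0# ≤ x → x ≤ y → y ≤ b → 0# ≤ q →
        h - g ≤ q → g ≤ M → y * h - x * g ≤ b * q + (y - x) * M
      product-slope {x} {y} {g} {h} 0≤x x≤y y≤b 0≤q h-g≤q g≤M = ≤-resp
        (solve 4 (λ x y g h → y :* (h :- g) :+ (y :- x) :* g := y :* h :- x :* g) refl x y g h) refl
        (+-mono-≤ (≤-trans (*-monoˡ-≤ (≤-trans 0≤x x≤y) h-g≤q) (*-monoʳ-≤ 0≤q y≤b))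
                  (*-monoˡ-≤ (0≤b-a x≤y) g≤M))

    -- One Horner step uses y h - x g = y (h - g) + (y - x) g, whence the constant b L + M. The
    -- opposite inequality is the same estimate applied to the negated values - g and - h.
    polynomial-lipschitz : ∀ p → ∃ λ L → 0# ≤ L × IsLipschitzOn b (λ x → evalℝ x p) L
    polynomial-lipschitz []      = 0# , inj₂ refl , λ x y _ _ _ → zero-slope x y , zero-slope x y
      where
      zero-slope : ∀ x y → 0# - 0# ≤ 0# * (y - x)
      zero-slope x y = inj₂ (trans (-‿inverseʳ 0#) (sym (zeroˡ _)))
    polynomial-lipschitz (a ∷ p) with polynomial-bounded p | polynomial-lipschitz p
    ... | M , 0≤M , bound | L , 0≤L , slope =
      b * L + M , 0≤+0≤ (0≤*0≤ 0≤b 0≤L) 0≤M , λ x y 0≤x x≤y y≤b →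
        let up , down = slope x y 0≤x x≤y y≤b
            g≤M , -g≤M = bound x 0≤x (≤-trans x≤y y≤b)
            0≤q = 0≤*0≤ 0≤L (0≤b-a x≤y)
        in ≤-resp (difference x y _ _) (slopes x y) (product-slope 0≤x x≤y y≤b 0≤q up g≤M) ,
           ≤-resp (neg-difference x y _ _) (slopes x y)
             (product-slope 0≤x x≤y y≤b 0≤q (≤-resp (swap _ _) refl down) -g≤M)
      where
      slopes : ∀ x y → b * (L * (y - x)) + (y - x) * M ≈ (b * L + M) * (y - x)
      slopes x y = solve 4 (λ b l d m → b :* (l :* d) :+ d :* m := (b :* l :+ m) :* d) refl b L (y - x) M

      difference : ∀ x y g h → y * h - x * g ≈ (a + y * h) - (a + x * g)
      difference x y g h = solve 3 (λ a u v → u :- v := (a :+ u) :- (a :+ v)) refl a (y * h) (x * g)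

      neg-difference : ∀ x y g h → y * - h - x * - g ≈ (a + x * g) - (a + y * h)
      neg-difference = solve 5 (λ a x y g h → y :* (:- h) :- x :* (:- g) := (a :+ x :* g) :- (a :+ y :* h)) refl a

      swap : ∀ g h → g - h ≈ - h - - g
      swap = solve 2 (λ g h → g :- h := :- h :- (:- g)) refl

  -- Positivity before x, rather than mere absence of zeros, is recorded because the induction on h
  -- reuses the sign.
  IsFirstZero : (ℝ → ℝ) → ℝ → Set ℓ
  IsFirstZero f x = 0# < x × f x ≈ 0# × (∀ y → 0# ≤ y → y < x → 0# < f y)

  private
    x-[x-y] : ∀ x y → x - (x - y) ≈ y
    x-[x-y] = solve 2 (λ x y → x :- (x :- y) := y) refl

    [x+y]-x : ∀ x y → (x + y) - x ≈ y
    [x+y]-x = solve 2 (λ x y → (x :+ y) :- x := y) refl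

    [b-x]-y : ∀ b x y → (b - x) - y ≈ b - (x + y)
    [b-x]-y = solve 3 (λ b x y → (b :- x) :- y := b :- (x :+ y)) refl

    -- δ = p q / (p + L q) satisfies both L δ < p and δ ≤ q.
    small-step : ∀ {L p q} → 0# ≤ L → 0# < p → 0# < q → ∃ λ δ → 0# < δ × δ ≤ q × L * δ < p
    small-step {L} {p} {q} 0≤L 0<p 0<q = δ , *-pos (*-pos 0<p 0<q) 0<e ,
      0≤b-a⇒a≤b (≤-resp refl
        (trans (id₁ p q L e) (+-congʳ (trans (*-congˡ (inverse-* D≉0)) (*-identityʳ q))))
        (0≤*0≤ (inj₁ 0<q) (0≤*0≤ (0≤*0≤ 0≤L (inj₁ 0<q)) (inj₁ 0<e)))) ,
      0<b-a⇒a<b (<-respʳ-≈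
        (trans (id₂ p q L e) (+-congʳ (trans (*-congˡ (inverse-* D≉0)) (*-identityʳ p))))
        (*-pos 0<p (*-pos 0<p 0<e)))
      where
      0<D : 0# < p + L * q
      0<D = 0<+0≤ 0<p (0≤*0≤ 0≤L (inj₁ 0<q))
      D≉0 = <⇒≉ 0<D
      e = inverse D≉0
      0<e : 0# < e
      0<e = inverse-pos 0<D (inverse-* D≉0)
      δ = (p * q) * e
      id₁ : ∀ p q l e → q * ((l * q) * e) ≈ q * (e * (p + l * q)) - (p * q) * e
      id₁ = solve 4 (λ p q l e → q :* ((l :* q) :* e) := q :* (e :* (p :+ l :* q)) :- (p :* q) :* e) refl
      id₂ : ∀ p q l e → p * (p * e) ≈ p * (e * (p + l * q)) - l * ((p * q) * e)
      id₂ = solve 4 (λ p q l e → p :* (p :* e) := p :* (e :* (p :+ l :* q)) :- l :* ((p :* q) :* e)) refl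

  module _ {f : ℝ → ℝ} {b L : ℝ} (f-cong : ∀ {x y} → x ≈ y → f x ≈ f y) (0≤L : 0# ≤ L)
           (slope : IsLipschitzOn b f L) (0<b : 0# < b) (0<f0 : 0# < f 0#) (fb<0 : f b < 0#) where
    private
      -- Demanding positivity on all of [0, t], not only at t, makes the supremum the first zero
      -- instead of a later sign change.
      PositiveUpTo : ℝ → Set ℓ
      PositiveUpTo t = 0# ≤ t × t ≤ b × (∀ y → 0# ≤ y → y ≤ t → 0# < f y)

      0∈S : PositiveUpTo 0#
      0∈S = inj₂ refl , inj₁ 0<b , λ y 0≤y y≤0 → <-respʳ-≈ (f-cong (≤-antisym 0≤y y≤0)) 0<f0

    supremum-first-zero : ∀ x₀ → UpperBound PositiveUpTo x₀ → (∀ {t} → UpperBound PositiveUpTo t → x₀ ≤ t) →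
      x₀ < b × IsFirstZero f x₀
    supremum-first-zero x₀ upper least = x₀<b , 0<x₀ , fx₀≈0 , f-positive
      where
      0≤x₀ : 0# ≤ x₀
      0≤x₀ = upper 0∈S

      x₀≤b : x₀ ≤ b
      x₀≤b = least (λ t∈S → proj₁ (proj₂ t∈S))

      f-positive : ∀ y → 0# ≤ y → y < x₀ → 0# < f y
      f-positive y 0≤y y<x₀ with ≤-<-connex (f y) 0#
      ... | inj₂ 0<fy = 0<fy
      -- A point y with f y ≤ 0 is itself an upper bound of `PositiveUpTo`, against the leastness of
      -- x₀.
      ... | inj₁ fy≤0 = ⊥-elim (<⇒≱ y<x₀ (least λ { (0≤t , t≤b , f>0) →
              ≮⇒≥ λ y<t → <⇒≱ (f>0 y 0≤y (inj₁ y<t)) fy≤0 }))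

      x₀≉b : f x₀ ≉ f b → x₀ < b
      x₀≉b ne with x₀≤b
      ... | inj₁ x₀<b = x₀<b
      ... | inj₂ x₀≈b = ⊥-elim (ne (f-cong x₀≈b))

      0≉x₀ : f x₀ ≉ f 0# → 0# < x₀
      0≉x₀ ne with 0≤x₀
      ... | inj₁ 0<x₀ = 0<x₀
      ... | inj₂ 0≈x₀ = ⊥-elim (ne (f-cong (sym 0≈x₀)))

      -- The Lipschitz bound keeps f negative at x₀ - δ as soon as L δ < - f x₀, contradicting
      -- positivity to the left of x₀.
      fx₀≮0 : ¬ (f x₀ < 0#)
      fx₀≮0 fx₀<0 = descend (small-step 0≤L (<0⇒0<- fx₀<0) 0<x₀′)
        where
        0<x₀′ : 0# < x₀
        0<x₀′ = 0≉x₀ λ fx₀≈f0 → <-irrefl refl (<-trans (<-respʳ-≈ (sym fx₀≈f0) 0<f0) fx₀<0)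
        descend : ¬ (∃ λ δ → 0# < δ × δ ≤ x₀ × L * δ < - f x₀)
        descend (δ , 0<δ , δ≤x₀ , Lδ<p) = <-asym (f-positive d 0≤d d<x₀) fd<0
          where
          d = x₀ - δ
          0≤d : 0# ≤ d
          0≤d = 0≤b-a δ≤x₀
          d<x₀ : d < x₀
          d<x₀ = 0<b-a⇒a<b (<-respʳ-≈ (sym (x-[x-y] x₀ δ)) 0<δ)
          fd<0 : f d < 0#
          fd<0 = +-cancel-< (- f x₀) (≤-<-trans
            (proj₂ (slope d x₀ 0≤d (inj₁ d<x₀) x₀≤b))
            (resp (*-congˡ (sym (x-[x-y] x₀ δ))) (sym (+-identityˡ _)) Lδ<p))

      -- Here positivity persists up to x₀ + δ, so x₀ would not be an upper bound; δ ≤ b - x₀ keeps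
      -- this point in the interval.
      fx₀≯0 : ¬ (0# < f x₀)
      fx₀≯0 0<fx₀ = ascend (small-step 0≤L 0<fx₀ (0<b-a x₀<b′))
        where
        x₀<b′ : x₀ < b
        x₀<b′ = x₀≉b λ fx₀≈fb → <-irrefl refl (<-trans 0<fx₀ (<-respˡ-≈ (sym fx₀≈fb) fb<0))
        ascend : ¬ (∃ λ δ → 0# < δ × δ ≤ b - x₀ × L * δ < f x₀)
        ascend (δ , 0<δ , δ≤b-x₀ , Lδ<p) = <⇒≱ x₀<d (upper (≤-trans 0≤x₀ (inj₁ x₀<d) , d≤b , f>0))
          where
          d = x₀ + δ
          x₀<d : x₀ < d
          x₀<d = 0<b-a⇒a<b (<-respʳ-≈ (sym ([x+y]-x x₀ δ)) 0<δ)
          d≤b : d ≤ b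
          d≤b = 0≤b-a⇒a≤b (≤-resp refl ([b-x]-y b x₀ δ) (0≤b-a δ≤b-x₀))
          f>0 : ∀ y → 0# ≤ y → y ≤ d → 0# < f y
          f>0 y 0≤y y≤d with ≤-<-connex x₀ y
          ... | inj₂ y<x₀ = f-positive y 0≤y y<x₀
          ... | inj₁ x₀≤y = <-respʳ-≈ (x-[x-y] (f x₀) (f y))
            (0<b-a (≤-<-trans (proj₂ (slope x₀ y 0≤x₀ x₀≤y (≤-trans y≤d d≤b)))
              (≤-<-trans (*-monoˡ-≤ 0≤L y-x₀≤δ) Lδ<p)))
            where
            y-x₀≤δ : y - x₀ ≤ δ
            y-x₀≤δ = ≤-resp refl ([x+y]-x x₀ δ) (+-mono-≤ y≤d (inj₂ refl))

      fx₀≈0 : f x₀ ≈ 0#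
      fx₀≈0 = ≤-antisym (≮⇒≥ fx₀≯0) (≮⇒≥ fx₀≮0)

      x₀<b : x₀ < b
      x₀<b = x₀≉b λ fx₀≈fb → <-irrefl (trans (sym fx₀≈fb) fx₀≈0) fb<0

      0<x₀ : 0# < x₀
      0<x₀ = 0≉x₀ λ fx₀≈f0 → <-irrefl (trans (sym fx₀≈0) fx₀≈f0) 0<f0

    first-zero : ∃ λ x → x < b × IsFirstZero f x
    first-zero = proj₁ sup , supremum-first-zero (proj₁ sup) (proj₁ (proj₂ sup)) (proj₂ (proj₂ sup))
      where sup = supremum PositiveUpTo (0# , 0∈S) (b , λ t∈S → proj₁ (proj₂ t∈S))

-- First zeros of the path polynomials

module PathFirstZero {ℓ} (𝓡 : RealNumbers ℓ) {r} (0<r : RealNumbers._<_ 𝓡 (RealNumbers.0# 𝓡) r) where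
  open Reals 𝓡 hiding (zero)
  open OrderedField
  open OrderedFieldLemmas 𝓡
  open FirstZeros 𝓡
  open ComplexZeros 𝓡 0<r
  open RingSolver commutativeRing
  open Continuants commutativeRing

  identity-homomorphism : Homomorphisms.IsRingHomomorphism commutativeRing commutativeRing (λ a → a)
  identity-homomorphism = Homomorphisms.ringHomomorphism commutativeRing commutativeRing
    (λ p → p) (λ _ _ → refl) (λ _ _ → refl) (λ _ → refl) refl refl

  eval-P : ∀ h x → eval rawRing (λ a → a) x (P h r) ≈ K x h
  eval-P h x = PathPolynomialValues.eval-pathPoly commutativeRing commutativeRing identity-homomorphism r h x

  K-lipschitz : ∀ {b} → 0# ≤ b → ∀ h → ∃ λ L → 0# ≤ L × IsLipschitzOn b (λ x → K x h) L
  K-lipschitz 0≤b h = proj₁ lipschitz , proj₁ (proj₂ lipschitz) , λ x y 0≤x x≤y y≤b →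
    let up , down = proj₂ (proj₂ lipschitz) x y 0≤x x≤y y≤b
    in ≤-resp (-‿cong₂ (eval-P h y) (eval-P h x)) refl up ,
       ≤-resp (-‿cong₂ (eval-P h x) (eval-P h y)) refl down
    where lipschitz = polynomial-lipschitz 0≤b (P h r)

  -- The last conjunct fixes the sign of the predecessor at x itself. It is restored at the next
  -- stage because the new zero lies strictly to the left of x, where the current continuant is
  -- still positive.
  K-first-zero : ∀ n → ∃ λ x → IsFirstZero (λ x → K x (suc (suc n))) x ×
    (∀ y → 0# ≤ y → y ≤ x → 0# < K y (suc n))
  K-first-zero zero = 1# , (0<1 , trans (K₂ 1#) (-‿inverseʳ 1#) ,
      λ y _ y<1 → <-respʳ-≈ (sym (K₂ y)) (0<b-a y<1)) ,
    λ _ _ _ → 0<1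
    where
    K₂ : ∀ y → K y 2 ≈ 1# - y
    K₂ = solve 1 (λ y → con (1 , 0) :- (y :* con (1 , 0)) :* con (1 , 0) := con (1 , 0) :- y) refl
  K-first-zero (suc n) = next (K-first-zero n)
    where
    h = suc (suc (suc n))
    next : (∃ λ x → IsFirstZero (λ x → K x (suc (suc n))) x × (∀ y → 0# ≤ y → y ≤ x → 0# < K y (suc n))) →
      ∃ λ x → IsFirstZero (λ x → K x h) x × (∀ y → 0# ≤ y → y ≤ x → 0# < K y (suc (suc n)))
    next (x , (0<x , Kx≈0 , K>0) , K>0′) = proj₁ zero′ , proj₂ (proj₂ zero′) ,
      λ y 0≤y y≤x′ → K>0 y 0≤y (≤-<-trans y≤x′ (proj₁ (proj₂ zero′)))
      where
      K<0 : K x h < 0#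
      K<0 = <-respˡ-≈ (sym (trans (continuant-last _ (suc n)) (-‿cong₂ Kx≈0 refl)))
        (0<b-a⇒a<b (<-respʳ-≈ (solve 1 (λ a → a := con (0 , 0) :- (con (0 , 0) :- a)) refl _)
          (*-pos (*-pos 0<x (0<^ 0<r (suc n))) (K>0′ x (inj₁ 0<x) (inj₂ refl)))))
      zero′ : ∃ λ x′ → x′ < x × IsFirstZero (λ x → K x h) x′
      zero′ = first-zero (λ p → K-cong p h) (proj₁ (proj₂ lipschitz)) (proj₂ (proj₂ lipschitz)) 0<x
        (K-positive (inj₂ refl) h) K<0
        where lipschitz = K-lipschitz (inj₁ 0<x) h

-- Eigenvectors of weighted paths

module PathEigenvectors (R : CommutativeRing c ℓ) where
  open CommutativeRing R hiding (zero)
  open Matrices rawRing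
  open Continuants R
  open RingSolver R
  open Algebra.Properties.Semiring.Sum semiring using (sum; sum-cong-≋; sum-replicate-zero)
  open Algebra.Definitions.RawSemiring (RawRing.rawSemiring rawRing) using (_^_)
  open Relation.Binary.Reasoning.Setoid setoid

  -- Padding with zeros encodes the boundary condition v_n = 0: the last row of the eigenvector
  -- equation acquires the three-term form of the others.
  extend : ∀ {n} → (Fin n → Carrier) → ℕ → Carrier
  extend {zero}  v k       = 0#
  extend {suc n} v zero    = v zero
  extend {suc n} v (suc k) = extend (λ i → v (suc i)) k

  extend-toℕ : ∀ {n} (v : Fin n → Carrier) i → extend v (toℕ i) ≈ v i
  extend-toℕ v zero    = refl
  extend-toℕ v (suc i) = extend-toℕ (λ i → v (suc i)) i

  extend-length : ∀ n (v : Fin n → Carrier) → extend v n ≈ 0#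
  extend-length zero    v = refl
  extend-length (suc n) v = extend-length n (λ i → v (suc i))

  extend-restrict : ∀ n (v : ℕ → Carrier) k → k <ℕ n → extend {n} (λ i → v (toℕ i)) k ≈ v k
  extend-restrict (suc n) v zero    _         = refl
  extend-restrict (suc n) v (suc k) (s≤s k<n) = extend-restrict n (λ k → v (suc k)) k k<n

  -- The index m may lie beyond the vector; `extend` then contributes zero, so the ends of the path
  -- need no separate treatment.
  sum-single : ∀ {n} (g : ℕ → Carrier) (v : Fin n → Carrier) m → (∀ k → k ≡.≢ m → g k ≈ 0#) →
    sum (λ j → g (toℕ j) * v j) ≈ g m * extend v m
  sum-single {zero}  g v m       p = sym (zeroʳ _)
  sum-single {suc n} g v zero    p = trans (+-congˡ (trans
    (sum-cong-≋ {n} λ j → trans (*-congʳ (p (suc (toℕ j)) λ ())) (zeroˡ _)) (sum-replicate-zero n)))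
    (+-identityʳ _)
  sum-single {suc n} g v (suc m) p = trans
    (+-cong (trans (*-congʳ (p 0 λ ())) (zeroˡ _))
      (sum-single (λ k → g (suc k)) (λ i → v (suc i)) m λ k k≢m → p (suc k) (k≢m ∘ ℕₚ.suc-injective)))
    (+-identityˡ _)

  sum-neighbours : ∀ {n} (g : ℕ → Carrier) (v : Fin n → Carrier) m →
    (∀ k → k ≡.≢ m → k ≡.≢ suc (suc m) → g k ≈ 0#) →
    sum (λ j → g (toℕ j) * v j) ≈ g m * extend v m + g (suc (suc m)) * extend v (suc (suc m))
  sum-neighbours {zero}  g v m       p = sym (trans (+-cong (zeroʳ _) (zeroʳ _)) (+-identityˡ _))
  sum-neighbours {suc n} g v zero    p = +-congˡ
    (sum-single (λ k → g (suc k)) (λ i → v (suc i)) 1 λ k k≢1 → p (suc k) (λ ()) (k≢1 ∘ ℕₚ.suc-injective))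
  sum-neighbours {suc n} g v (suc m) p = trans
    (+-cong (trans (*-congʳ (p 0 (λ ()) λ ())) (zeroˡ _))
      (sum-neighbours (λ k → g (suc k)) (λ i → v (suc i)) m λ k k≢m k≢m+2 →
        p (suc k) (k≢m ∘ ℕₚ.suc-injective) (k≢m+2 ∘ ℕₚ.suc-injective)))
    (+-identityˡ _)

  -- The rows before N of the eigenvalue equation for the weighted path.
  record IsPathEigensequence (w : ℕ → Carrier) (μ : Carrier) (N : ℕ) (v : ℕ → Carrier) : Set ℓ where
    field
      row-zero : 0 <ℕ N → w 0 * v 1 ≈ μ * v 0
      row-suc  : ∀ k → suc k <ℕ N → w k * v k + w (suc k) * v (suc (suc k)) ≈ μ * v (suc k)

  -- The product w_0 ... w_(k-1), the denominator accumulated when the rows are solved successively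
  -- for v_k.
  weightProduct : (ℕ → Carrier) → ℕ → Carrier
  weightProduct w zero    = 1#
  weightProduct w (suc k) = w k * weightProduct w k

  -- Row k+1, multiplied by w_0 ... w_k, expresses v_(k+2) through the two preceding entries.
  -- Inserting μ² z = 1 in front of w_k² turns this into the last-end recurrence of the continuant,
  -- times a power of μ.
  eigensequence-continuant : ∀ {w μ N v z} → IsPathEigensequence w μ N v → μ * μ * z ≈ 1# →
    ∀ k → k ≤ℕ N → weightProduct w k * v k ≈ μ ^ k * continuant (λ k → z * (w k * w k)) k * v 0
  eigensequence-continuant {w} {μ} {N} {v} {z} E μ²z≈1 = go
    where
    open IsPathEigensequence E
    β = weightProduct w
    K = continuant (λ k → z * (w k * w k))

    go : ∀ k → k ≤ℕ N → β k * v k ≈ μ ^ k * K k * v 0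
    go zero          _   = *-congʳ (sym (*-identityˡ 1#))
    go (suc zero)    0<N = begin
      w 0 * 1# * v 1          ≈⟨ solve 2 (λ w v → w :* con (1 , 0) :* v := w :* v) refl (w 0) (v 1) ⟩
      w 0 * v 1               ≈⟨ row-zero 0<N ⟩
      μ * v 0                 ≈⟨ solve 2 (λ m v → m :* v := m :* con (1 , 0) :* con (1 , 0) :* v) refl μ (v 0) ⟩
      μ ^ 1 * 1# * v 0        ∎
    go (suc (suc k)) k+1<N = begin
      (w (suc k) * (w k * β k)) * v (suc (suc k))
        ≈⟨ solve 5 (λ x y b u v → (x :* (y :* b)) :* v :=
             (y :* b) :* (y :* u :+ x :* v) :- (y :* y) :* (b :* u)) refl
             (w (suc k)) (w k) (β k) (v k) (v (suc (suc k))) ⟩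
      (w k * β k) * (w k * v k + w (suc k) * v (suc (suc k))) - (w k * w k) * (β k * v k)
        ≈⟨ -‿cong₂ (trans (*-congˡ (row-suc k k+1<N)) (solve 3 (λ b m u → b :* (m :* u) := m :* (b :* u)) refl _ μ _))
                   (*-congˡ (go k (ℕₚ.≤-trans (ℕₚ.n≤1+n k) k+1≤N))) ⟩
      μ * (β (suc k) * v (suc k)) - (w k * w k) * (μ ^ k * K k * v 0)
        ≈⟨ -‿cong₂ (*-congˡ (go (suc k) k+1≤N))
                   (trans (sym (*-identityˡ _)) (*-congʳ (sym μ²z≈1))) ⟩
      μ * (μ ^ suc k * K (suc k) * v 0) - (μ * μ * z) * ((w k * w k) * (μ ^ k * K k * v 0))
        ≈⟨ solve 7 (λ m p x u z w y → m :* (m :* p :* x :* u) :- (m :* m :* z) :* (w :* (p :* y :* u)) :=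
             m :* (m :* p) :* (x :- (z :* w) :* y) :* u) refl μ (μ ^ k) (K (suc k)) (v 0) z (w k * w k) (K k) ⟩
      μ ^ suc (suc k) * (K (suc k) - (z * (w k * w k)) * K k) * v 0
        ≈⟨ *-congʳ (*-congˡ (continuant-last (λ k → z * (w k * w k)) k)) ⟨
      μ ^ suc (suc k) * K (suc (suc k)) * v 0 ∎
      where k+1≤N = ℕₚ.≤-trans (ℕₚ.n≤1+n (suc k)) k+1<N

  -- ℂ enters only as a commutative ring, so divisions are justified element by element.
  IsUnit : Carrier → Set _
  IsUnit x = ∃ λ y → y * x ≈ 1#

  IsUnit-* : ∀ {x y} → IsUnit x → IsUnit y → IsUnit (x * y)
  IsUnit-* {x} {y} (x⁻¹ , p) (y⁻¹ , q) = x⁻¹ * y⁻¹ , trans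
    (solve 4 (λ a b x y → (a :* b) :* (x :* y) := (a :* x) :* (b :* y)) refl x⁻¹ y⁻¹ x y)
    (trans (*-cong p q) (*-identityˡ 1#))

  IsUnit-1 : IsUnit 1#
  IsUnit-1 = 1# , *-identityˡ 1#

  IsUnit-^ : ∀ {x} → IsUnit x → ∀ k → IsUnit (x ^ k)
  IsUnit-^ u zero    = IsUnit-1
  IsUnit-^ u (suc k) = IsUnit-* u (IsUnit-^ u k)

  unit-cancel : ∀ {x y} → IsUnit x → x * y ≈ 0# → y ≈ 0#
  unit-cancel {x} {y} (x⁻¹ , p) xy≈0 = begin
    y                ≈⟨ *-identityˡ y ⟨
    1# * y           ≈⟨ *-congʳ p ⟨
    x⁻¹ * x * y      ≈⟨ *-assoc _ _ _ ⟩
    x⁻¹ * (x * y)    ≈⟨ *-congˡ xy≈0 ⟩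
    x⁻¹ * 0#         ≈⟨ zeroʳ _ ⟩
    0#               ∎

  record IsWeightedPath (e : ℕ → ℕ → Carrier) (w : ℕ → Carrier) : Set ℓ where
    field
      above       : ∀ i → e i (suc i) ≈ w i
      below       : ∀ i → e (suc i) i ≈ w i
      nonadjacent : ∀ {i j} → j ≡.≢ suc i → i ≡.≢ suc j → e i j ≈ 0#

  module _ {e : ℕ → ℕ → Carrier} {w : ℕ → Carrier} (path : IsWeightedPath e w)
           (w-unit : ∀ k → IsUnit (w k)) {n} {M : Matrix n}
           (M≈e : ∀ i j → M i j ≈ e (toℕ i) (toℕ j)) where
    open IsWeightedPath path

    private
      K : Carrier → Carrier
      K z = continuant (λ k → z * (w k * w k)) n

      row : ∀ (v : Fin n → Carrier) i → sum (λ j → M i j * v j) ≈ sum (λ j → e (toℕ i) (toℕ j) * v j)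
      row v i = sum-cong-≋ {n} λ j → *-congʳ (M≈e i j)

      row₀ : ∀ (v : Fin n → Carrier) i → toℕ i ≡.≡ 0 → sum (λ j → M i j * v j) ≈ w 0 * extend v 1
      row₀ v i i≡0 = begin
        sum (λ j → M i j * v j)         ≈⟨ row v i ⟩
        sum (λ j → e (toℕ i) (toℕ j) * v j)   ≡⟨ ≡.cong (λ m → sum {n} (λ j → e m (toℕ j) * v j)) i≡0 ⟩
        sum (λ j → e 0 (toℕ j) * v j)   ≈⟨ sum-single (e 0) v 1 (λ k k≢1 → nonadjacent k≢1 λ ()) ⟩
        e 0 1 * extend v 1              ≈⟨ *-congʳ (above 0) ⟩
        w 0 * extend v 1                ∎

      row₊ : ∀ (v : Fin n → Carrier) i k → toℕ i ≡.≡ suc k →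
        sum (λ j → M i j * v j) ≈ w k * extend v k + w (suc k) * extend v (suc (suc k))
      row₊ v i k i≡k+1 = begin
        sum (λ j → M i j * v j)               ≈⟨ row v i ⟩
        sum (λ j → e (toℕ i) (toℕ j) * v j)   ≡⟨ ≡.cong (λ m → sum {n} (λ j → e m (toℕ j) * v j)) i≡k+1 ⟩
        sum (λ j → e (suc k) (toℕ j) * v j)   ≈⟨ sum-neighbours (e (suc k)) v k
          (λ l l≢k l≢k+2 → nonadjacent l≢k+2 (l≢k ∘ ≡.sym ∘ ℕₚ.suc-injective)) ⟩
        e (suc k) k * extend v k + e (suc k) (suc (suc k)) * extend v (suc (suc k))
          ≈⟨ +-cong (*-congʳ (below k)) (*-congʳ (above (suc k))) ⟩
        w k * extend v k + w (suc k) * extend v (suc (suc k)) ∎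

      weightProduct-unit : ∀ k → IsUnit (weightProduct w k)
      weightProduct-unit zero    = IsUnit-1
      weightProduct-unit (suc k) = IsUnit-* (w-unit k) (weightProduct-unit k)

    eigenvector-eigensequence : ∀ {μ v} → (∀ i → sum (λ j → M i j * v j) ≈ μ * v i) →
      IsPathEigensequence w μ n (extend v)
    eigenvector-eigensequence {μ} {v} eigen = record
      { row-zero = λ 0<n → let i = Fin.fromℕ< 0<n ; i≡ = Finₚ.toℕ-fromℕ< 0<n in
          trans (sym (row₀ v i i≡)) (trans (eigen i) (*-congˡ (at i≡)))
      ; row-suc  = λ k k+1<n → let i = Fin.fromℕ< k+1<n ; i≡ = Finₚ.toℕ-fromℕ< k+1<n in
          trans (sym (row₊ v i k i≡)) (trans (eigen i) (*-congˡ (at i≡)))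
      }
      where
      at : ∀ {i m} → toℕ i ≡.≡ m → v i ≈ extend v m
      at {i} ≡.refl = sym (extend-toℕ v i)

    -- Invertible weights let the first entry determine all others; hence a nonzero eigenvector has
    -- a nonzero first entry.
    eigensequence-zero : ∀ {μ z v} → μ * μ * z ≈ 1# → IsPathEigensequence w μ n v → v 0 ≈ 0# →
      ∀ k → k ≤ℕ n → v k ≈ 0#
    eigensequence-zero μ²z≈1 E v₀≈0 k k≤n = unit-cancel (weightProduct-unit k)
      (trans (eigensequence-continuant E μ²z≈1 k k≤n) (trans (*-congˡ v₀≈0) (zeroʳ _)))

    eigenvector-zero : ∀ {μ z v} → μ * μ * z ≈ 1# → (∀ i → sum (λ j → M i j * v j) ≈ μ * v i) →
      extend v 0 ≈ 0# → ∀ i → v i ≈ 0#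
    eigenvector-zero {v = v} μ²z≈1 eigen v₀≈0 i = trans (sym (extend-toℕ v i))
      (eigensequence-zero μ²z≈1 (eigenvector-eigensequence eigen) v₀≈0 (toℕ i) (ℕₚ.<⇒≤ (Finₚ.toℕ<n i)))

    μ-unit : ∀ {μ z} → μ * μ * z ≈ 1# → IsUnit μ
    μ-unit {μ} {z} p = μ * z , trans (solve 2 (λ m z → (m :* z) :* m := m :* m :* z) refl μ z) p

    -- At k = n the padded entry makes the continuant formula vanish, and the units μ^n and v_0 can
    -- be cancelled.
    eigenvalue-continuant : ∀ {μ z v} → μ * μ * z ≈ 1# → (∀ i → sum (λ j → M i j * v j) ≈ μ * v i) →
      IsUnit (extend v 0) → K z ≈ 0#
    eigenvalue-continuant {μ} {z} {v} μ²z≈1 eigen v₀-unit =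
      unit-cancel v₀-unit (trans (*-comm _ _) (unit-cancel (IsUnit-^ (μ-unit μ²z≈1) n) (begin
        μ ^ n * (K z * extend v 0)          ≈⟨ *-assoc _ _ _ ⟨
        μ ^ n * K z * extend v 0            ≈⟨ eigensequence-continuant (eigenvector-eigensequence eigen) μ²z≈1 n ℕₚ.≤-refl ⟨
        weightProduct w n * extend v n      ≈⟨ *-congˡ (extend-length n v) ⟩
        weightProduct w n * 0#              ≈⟨ zeroʳ _ ⟩
        0#                                  ∎)))

    -- Solves the rows one after another from v_0 = 1 on the infinite path, which is possible for
    -- every μ. Only the truncation condition v_n = 0 singles out eigenvalues.
    eigensequence : Carrier → ℕ → Carrier
    eigensequence μ zero          = 1#
    eigensequence μ (suc zero)    = proj₁ (w-unit 0) * μ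
    eigensequence μ (suc (suc k)) =
      proj₁ (w-unit (suc k)) * (μ * eigensequence μ (suc k) - w k * eigensequence μ k)

    private
      cancel : ∀ k x → w k * (proj₁ (w-unit k) * x) ≈ x
      cancel k x = trans (sym (*-assoc _ _ _))
        (trans (*-congʳ (trans (*-comm _ _) (proj₂ (w-unit k)))) (*-identityˡ x))

    eigensequence-isPathEigensequence : ∀ μ → IsPathEigensequence w μ n (eigensequence μ)
    eigensequence-isPathEigensequence μ = record
      { row-zero = λ _ → trans (cancel 0 μ) (sym (*-identityʳ μ))
      ; row-suc  = λ k _ → trans (+-congˡ (cancel (suc k) _))
          (solve 2 (λ x y → x :+ (y :- x) := y) refl _ _)
      }

    continuant-eigenvector : ∀ {μ z} → μ * μ * z ≈ 1# → K z ≈ 0# →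
      ∀ i → sum (λ j → M i j * eigensequence μ (toℕ j)) ≈ μ * eigensequence μ (toℕ i)
    continuant-eigenvector {μ} {z} μ²z≈1 Kz≈0 i = go (toℕ i) ≡.refl
      where
      E = eigensequence-isPathEigensequence μ
      open IsPathEigensequence E
      v = eigensequence μ

      vₙ≈0 : v n ≈ 0#
      vₙ≈0 = unit-cancel (weightProduct-unit n) (begin
        weightProduct w n * v n   ≈⟨ eigensequence-continuant E μ²z≈1 n ℕₚ.≤-refl ⟩
        μ ^ n * K z * 1#          ≈⟨ *-identityʳ _ ⟩
        μ ^ n * K z               ≈⟨ *-congˡ Kz≈0 ⟩
        μ ^ n * 0#                ≈⟨ zeroʳ _ ⟩
        0#                        ∎)

      v̂ = extend {n} (λ j → v (toℕ j))

      -- The infinite sequence and its zero-padded truncation agree at index n exactly by `vₙ≈0`;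
      -- the last row reads that entry.
      extend-v : ∀ k → k ≤ℕ n → v̂ k ≈ v k
      extend-v k k≤n with k ℕ.≟ n
      ... | yes ≡.refl = trans (extend-length n _) (sym vₙ≈0)
      ... | no k≢n     = extend-restrict n v k (ℕₚ.≤∧≢⇒< k≤n k≢n)

      go : ∀ m → toℕ i ≡.≡ m → sum (λ j → M i j * v (toℕ j)) ≈ μ * v (toℕ i)
      go zero i≡0 = begin
        sum (λ j → M i j * v (toℕ j))       ≈⟨ row₀ (λ j → v (toℕ j)) i i≡0 ⟩
        w 0 * v̂ 1    ≈⟨ *-congˡ (extend-v 1 0<n) ⟩
        w 0 * v 1                           ≈⟨ row-zero 0<n ⟩
        μ * v 0                             ≡⟨ ≡.cong (λ m → μ * v m) i≡0 ⟨
        μ * v (toℕ i)                       ∎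
        where 0<n = ≡.subst (_<ℕ n) i≡0 (Finₚ.toℕ<n i)
      go (suc k) i≡k+1 = begin
        sum (λ j → M i j * v (toℕ j))       ≈⟨ row₊ (λ j → v (toℕ j)) i k i≡k+1 ⟩
        w k * v̂ k + w (suc k) * v̂ (suc (suc k))
          ≈⟨ +-cong (*-congˡ (extend-v k (ℕₚ.<⇒≤ (ℕₚ.<⇒≤ k+1<n)))) (*-congˡ (extend-v (suc (suc k)) k+1<n)) ⟩
        w k * v k + w (suc k) * v (suc (suc k))   ≈⟨ row-suc k k+1<n ⟩
        μ * v (suc k)                       ≡⟨ ≡.cong (λ m → μ * v m) i≡k+1 ⟨
        μ * v (toℕ i)                       ∎
        where k+1<n = ≡.subst (_<ℕ n) i≡k+1 (Finₚ.toℕ<n i)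

-- The spectral radius from the first zero

module SpectralRadius {ℓ} (𝓡 : RealNumbers ℓ) {r} (0<r : RealNumbers._<_ 𝓡 (RealNumbers.0# 𝓡) r) where
  open Reals 𝓡 hiding (zero)
  open OrderedField
  open OrderedFieldLemmas 𝓡
  open ComplexNumbers 𝓡
  open ComplexZeros 𝓡 0<r
  open FirstZeros 𝓡
  open RingSolver commutativeRing
  open PathMatrix 𝓡
    using (pathEntry; A-pathEntry; pathEntry-above; pathEntry-below; pathEntry-nonadjacent; s^-square)
  private
    module ℂ = CommutativeRing complexCommutativeRing
    module Cℂ = Continuants complexCommutativeRing
    module E = PathEigenvectors complexCommutativeRing
    module MC = Matrices complexRing
  open RingMorphisms.IsRingHomomorphism ofReal-homomorphism using (*-homo; ⟦⟧-cong)

  norm² : ℂ → ℝ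
  norm² z = Re z * Re z + Im z * Im z

  norm²≈0⇒≈0 : ∀ z → ¬ (0# < norm² z) → z ≈ᶜ 0ᶜ
  norm²≈0⇒≈0 (a , b) n≯0 with compare a 0# | compare b 0#
  ... | tri< _ a≉0 _ | _ = ⊥-elim (n≯0 (0<+0≤ (0<a² a≉0) (0≤a² b)))
  ... | tri> _ a≉0 _ | _ = ⊥-elim (n≯0 (0<+0≤ (0<a² a≉0) (0≤a² b)))
  ... | tri≈ _ a≈0 _ | tri< _ b≉0 _ = ⊥-elim (n≯0 (0≤+0< (0≤a² a) (0<a² b≉0)))
  ... | tri≈ _ a≈0 _ | tri> _ b≉0 _ = ⊥-elim (n≯0 (0≤+0< (0≤a² a) (0<a² b≉0)))
  ... | tri≈ _ a≈0 _ | tri≈ _ b≈0 _ = a≈0 , b≈0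

  norm²-unit : ∀ z → 0# < norm² z → E.IsUnit z
  norm²-unit (a , b) 0<n = (a * i , - (b * i)) ,
    ( trans (solve 3 (λ a b i → (a :* i) :* a :- (:- (b :* i)) :* b := i :* (a :* a :+ b :* b)) refl a b i)
        (inverse-* (<⇒≉ 0<n))
    , solve 3 (λ a b i → (a :* i) :* b :+ (:- (b :* i)) :* a := con (0 , 0)) refl a b i)
    where i = inverse (<⇒≉ 0<n)

  zero-or-unit : ∀ z → z ≈ᶜ 0ᶜ ⊎ E.IsUnit z × 0# < norm² z
  zero-or-unit z with ≤-<-connex (norm² z) 0#
  ... | inj₁ n≤0 = inj₁ (norm²≈0⇒≈0 z λ 0<n → <⇒≱ 0<n n≤0)
  ... | inj₂ 0<n = inj₂ (norm²-unit z 0<n , 0<n)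

  ofReal-unit : ∀ {x} → 0# < x → E.IsUnit (ofReal x)
  ofReal-unit {x} 0<x = norm²-unit (ofReal x) (0<+0≤ (*-pos 0<x 0<x) (0≤a² 0#))

  weight : ℕ → ℂ
  weight k = ofReal (√ (inj₁ 0<r) ^ k)

  0<√r : 0# < √ (inj₁ 0<r)
  0<√r with √-nonneg (inj₁ 0<r)
  ... | inj₁ 0<s = 0<s
  ... | inj₂ 0≈s = ⊥-elim (<-irrefl
    (trans (sym (zeroˡ 0#)) (trans (*-cong 0≈s 0≈s) (√-square (inj₁ 0<r)))) 0<r)

  weight-unit : ∀ k → E.IsUnit (weight k)
  weight-unit k = ofReal-unit (0<^ 0<√r k)

  weightedPath : E.IsWeightedPath (λ i j → ofReal (pathEntry 0<r i j)) weight
  weightedPath = record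
    { above       = λ i → ⟦⟧-cong (reflexive (pathEntry-above 0<r i))
    ; below       = λ i → ⟦⟧-cong (reflexive (pathEntry-below 0<r i))
    ; nonadjacent = λ p q → ⟦⟧-cong (reflexive (pathEntry-nonadjacent 0<r p q))
    }

  Aᶜ : ∀ h → MC.Matrix h
  Aᶜ h = mapₘ ofReal (A h 0<r)

  Aᶜ-pathEntry : ∀ h i j → Aᶜ h i j ≈ᶜ ofReal (pathEntry 0<r (toℕ i) (toℕ j))
  Aᶜ-pathEntry h i j = ⟦⟧-cong (reflexive (A-pathEntry 0<r h i j))

  Kʷ : ℂ → ℕ → ℂ
  Kʷ z = Cℂ.continuant (λ k → z ℂ.* (weight k ℂ.* weight k))

  Kᶜ-weight : ∀ z h → Kᶜ z h ≈ᶜ Kʷ z h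
  Kᶜ-weight z = Cℂ.continuant-cong {λ k → z ℂ.* ofReal (r ^ k)} {λ k → z ℂ.* (weight k ℂ.* weight k)}
    λ k → ℂ.*-congˡ {z} {ofReal (r ^ k)} {weight k ℂ.* weight k}
      (ℂ.trans {ofReal (r ^ k)} {ofReal (s ^ k * s ^ k)} {weight k ℂ.* weight k}
        (sym (s^-square 0<r k) , refl) (*-homo (s ^ k) (s ^ k)))
    where s = √ (inj₁ 0<r)

  eigenvalue-zero : ∀ {h μ z} → μ ℂ.* μ ℂ.* z ≈ᶜ ℂ.1# → MC.IsEigenvalue (Aᶜ h) μ → Kᶜ z h ≈ᶜ 0ᶜ
  eigenvalue-zero {h} {μ} {z} μ²z≈1 (v , v≉0 , eigen) = by-first-entry (zero-or-unit (E.extend v 0))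
    where
    by-first-entry : E.extend v 0 ≈ᶜ 0ᶜ ⊎ E.IsUnit (E.extend v 0) × 0# < norm² (E.extend v 0) → Kᶜ z h ≈ᶜ 0ᶜ
    by-first-entry (inj₁ v₀≈0) = ⊥-elim (v≉0
      (E.eigenvector-zero weightedPath weight-unit (Aᶜ-pathEntry h) {μ} {z} {v} μ²z≈1 eigen v₀≈0))
    by-first-entry (inj₂ (v₀-unit , _)) = ℂ.trans {Kᶜ z h} {Kʷ z h} {0ᶜ} (Kᶜ-weight z h)
      (E.eigenvalue-continuant weightedPath weight-unit (Aᶜ-pathEntry h) {μ} {z} {v} μ²z≈1 eigen v₀-unit)

  -- Size `suc h` provides an entry 0, where `eigensequence` is 1, so the vector is nonzero.
  zero-eigenvalue : ∀ {h μ z} → μ ℂ.* μ ℂ.* z ≈ᶜ ℂ.1# → Kᶜ z (suc h) ≈ᶜ 0ᶜ → MC.IsEigenvalue (Aᶜ (suc h)) μ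
  zero-eigenvalue {h} {μ} {z} μ²z≈1 Kz≈0 = (λ i → v (toℕ i)) ,
    (λ v≈0 → <⇒≉ 0<1 (proj₁ (v≈0 zero))) ,
    E.continuant-eigenvector weightedPath weight-unit (Aᶜ-pathEntry (suc h)) {μ} {z} μ²z≈1
      (ℂ.trans {Kʷ z (suc h)} {Kᶜ z (suc h)} {0ᶜ}
        (ℂ.sym {Kᶜ z (suc h)} {Kʷ z (suc h)} (Kᶜ-weight z (suc h))) Kz≈0)
    where v = E.eigensequence weightedPath weight-unit (Aᶜ-pathEntry (suc h)) μ

  ∣_∣ᶜ² : ∀ z → ∣ z ∣ᶜ * ∣ z ∣ᶜ ≈ norm² z
  ∣ z ∣ᶜ² = √-square (0≤+0≤ (0≤a² (Re z)) (0≤a² (Im z)))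

  0≤∣_∣ᶜ : ∀ z → 0# ≤ ∣ z ∣ᶜ
  0≤∣ z ∣ᶜ = √-nonneg (0≤+0≤ (0≤a² (Re z)) (0≤a² (Im z)))

  -- For real z, the identity (a² + b²)² = (a² - b²)² + (2ab)² shows that the left-hand side squares
  -- to 1, so it cannot exceed 1.
  norm²-inverse-≤ : ∀ {μ z} → μ ℂ.* μ ℂ.* z ≈ᶜ ℂ.1# → Im z ≈ 0# → norm² μ * Re z ≤ 1#
  norm²-inverse-≤ {a , b} {x , y} (re , im) y≈0 = ≮⇒≥ λ 1<n →
    <-irrefl (sym (trans square (*-identityˡ 1#))) (<-respˡ-≈ (*-identityˡ 1#) (sq-mono (inj₁ 0<1) 1<n))
    where
    re′ : (a * a - b * b) * x ≈ 1#
    re′ = trans (sym (trans (+-congˡ (-‿cong (*-congˡ y≈0))) (solve 3 (λ a b x →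
      (a :* a :- b :* b) :* x :- (a :* b :+ b :* a) :* con (0 , 0) := (a :* a :- b :* b) :* x) refl a b x))) re
    im′ : (a * b + b * a) * x ≈ 0#
    im′ = trans (sym (trans (+-congʳ (*-congˡ y≈0)) (solve 3 (λ a b x →
      (a :* a :- b :* b) :* con (0 , 0) :+ (a :* b :+ b :* a) :* x := (a :* b :+ b :* a) :* x) refl a b x))) im
    square : ((a * a + b * b) * x) * ((a * a + b * b) * x) ≈ 1# * 1#
    square = trans (solve 3 (λ a b x →
        ((a :* a :+ b :* b) :* x) :* ((a :* a :+ b :* b) :* x) :=
        ((a :* a :- b :* b) :* x) :* ((a :* a :- b :* b) :* x) :+
        ((a :* b :+ b :* a) :* x) :* ((a :* b :+ b :* a) :* x)) refl a b x)
      (trans (+-cong (*-cong re′ re′) (*-cong im′ im′))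
        (solve 0 (con (1 , 0) :* con (1 , 0) :+ con (0 , 0) :* con (0 , 0) := con (1 , 0) :* con (1 , 0)) refl))

  -- The real number ρ itself attains the maximum, being the eigenvalue that corresponds to the zero
  -- x.
  first-zero-spectralRadius : ∀ {h x ρ} → IsFirstZero (λ x → K x (suc h)) x → 0# ≤ ρ → ρ * ρ * x ≈ 1# →
    IsSpectralRadius (A (suc h) 0<r) ρ
  first-zero-spectralRadius {h} {x} {ρ} (0<x , Kx≈0 , K>0) 0≤ρ ρ²x≈1 =
    (ofReal ρ , zero-eigenvalue {h} {ofReal ρ} {ofReal x} real-relation
        (ℂ.trans {Kᶜ (ofReal x) (suc h)} {ofReal (K x (suc h))} {0ᶜ} (Kᶜ-ofReal refl (suc h)) (Kx≈0 , refl))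
      , sq-injective 0≤ρ 0≤∣ ofReal ρ ∣ᶜ
          (sym (trans ∣ ofReal ρ ∣ᶜ² (solve 1 (λ p → p :* p :+ con (0 , 0) :* con (0 , 0) := p :* p) refl ρ))))
    , bound
    where
    real-relation : ofReal ρ ℂ.* ofReal ρ ℂ.* ofReal x ≈ᶜ ℂ.1#
    real-relation =
      trans (solve 2 (λ p x → (p :* p :- con (0 , 0) :* con (0 , 0)) :* x :-
        (p :* con (0 , 0) :+ con (0 , 0) :* p) :* con (0 , 0) := p :* p :* x) refl ρ x) ρ²x≈1 ,
      solve 2 (λ p x → (p :* p :- con (0 , 0) :* con (0 , 0)) :* con (0 , 0) :+
        (p :* con (0 , 0) :+ con (0 , 0) :* p) :* x := con (0 , 0)) refl ρ x

    bound : ∀ μ → MC.IsEigenvalue (Aᶜ (suc h)) μ → ∣ μ ∣ᶜ ≤ ρ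
    bound μ eigen = by-cases (zero-or-unit μ)
      where
      norm²-bound : E.IsUnit μ → 0# < norm² μ → norm² μ * x ≤ 1#
      norm²-bound (i , iμ≈1) 0<n =
        ≤-trans (*-monoˡ-≤ (inj₁ 0<n) x≤Re) (norm²-inverse-≤ {μ} {z} μ²z≈1 Im≈0)
        where
        z = i ℂ.* i
        μ²z≈1 : μ ℂ.* μ ℂ.* z ≈ᶜ ℂ.1#
        μ²z≈1 = ℂ.trans {μ ℂ.* μ ℂ.* z} {z ℂ.* (μ ℂ.* μ)} {ℂ.1#} (ℂ.*-comm (μ ℂ.* μ) z)
          (proj₂ (E.IsUnit-* {μ} {μ} (i , iμ≈1) (i , iμ≈1)))
        Kz≈0 : Kᶜ z (suc h) ≈ᶜ 0ᶜ
        Kz≈0 = eigenvalue-zero {suc h} {μ} {z} μ²z≈1 eigen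
        Im≈0 : Im z ≈ 0#
        Im≈0 = proj₁ (Kᶜ-zeros-positive z (suc h) Kz≈0)
        0<Re : 0# < Re z
        0<Re = proj₂ (Kᶜ-zeros-positive z (suc h) Kz≈0)
        x≤Re : x ≤ Re z
        x≤Re = ≮⇒≥ λ Re<x → <⇒≉ (K>0 (Re z) (inj₁ 0<Re) Re<x)
          (trans (sym (proj₁ (Kᶜ-ofReal {z} Im≈0 (suc h)))) (proj₁ Kz≈0))

      by-cases : μ ≈ᶜ 0ᶜ ⊎ E.IsUnit μ × 0# < norm² μ → ∣ μ ∣ᶜ ≤ ρ
      by-cases (inj₁ (a≈0 , b≈0)) = sq-≤-cancel 0≤ρ (≤-resp
        (sym (trans ∣ μ ∣ᶜ² (trans (+-cong (*-cong a≈0 a≈0) (*-cong b≈0 b≈0))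
          (trans (+-cong (zeroˡ 0#) (zeroˡ 0#)) (+-identityˡ 0#)))))
        refl (0≤a² ρ))
      -- The squares are compared after multiplication by x > 0, where ρ² x = 1.
      by-cases (inj₂ (unit , 0<n)) = sq-≤-cancel 0≤ρ (≤-resp (sym ∣ μ ∣ᶜ²) refl
        (≮⇒≥ λ ρ²<n → <⇒≱ (*-monoˡ 0<x ρ²<n) (≤-resp refl (sym ρ²x≈1) (norm²-bound unit 0<n))))

-- Determinant formula, positivity of zeros and the smallest zero

proposition7p1 : ∀ {ℓ} (𝓡 : RealNumbers ℓ) → let open Reals 𝓡 in
    ∀ (h : ℕ) (r : ℝ) (0<r : 0# < r) →
      P h r IsInXFor detI-√X (A h 0<r)
      × (2 ≤ℕ h →
          (∀ z → IsComplexZero (P h r) z → Im z ≈ 0# × 0# < Re z)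
          × (∃ λ ρ → IsSpectralRadius (A h 0<r) ρ
               × Σ (ρ * ρ ≉ 0#) λ Λ≉0 →
                   IsSmallestPositiveZero (P h r) (inverse Λ≉0)))
proposition7p1 {ℓ} 𝓡 h r 0<r = PathMatrix.P-IsInXFor-det 𝓡 0<r h , λ 2≤h → zeros-positive , radius h 2≤h
  where
  open Reals 𝓡 hiding (zero)
  open OrderedField
  open OrderedFieldLemmas 𝓡
  open ComplexNumbers 𝓡
  open ComplexZeros 𝓡 0<r
  open FirstZeros 𝓡 using (IsFirstZero)
  open PathFirstZero 𝓡 0<r
  open SpectralRadius 𝓡 0<r
  module ℂ = CommutativeRing complexCommutativeRing

  zeros-positive : ∀ z → IsComplexZero (P h r) z → Im z ≈ 0# × 0# < Re z
  zeros-positive z Pz≈0 = Kᶜ-zeros-positive z h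
    (ℂ.trans {Kᶜ z h} {eval complexRing ofReal z (P h r)} {0ᶜ}
      (ℂ.sym {eval complexRing ofReal z (P h r)} {Kᶜ z h}
        (PathPolynomialValues.eval-pathPoly commutativeRing complexCommutativeRing ofReal-homomorphism r h z)) Pz≈0)

  radius : ∀ h → 2 ≤ℕ h → ∃ λ ρ → IsSpectralRadius (A h 0<r) ρ
    × Σ (ρ * ρ ≉ 0#) λ Λ≉0 → IsSmallestPositiveZero (P h r) (inverse Λ≉0)
  radius (suc (suc n)) (s≤s (s≤s _)) = ρ , first-zero-spectralRadius first (√-nonneg 0≤x⁻¹) ρ²x≈1 ,
    Λ≉0 , ((<-respʳ-≈ (sym Λ⁻¹≈x) 0<x ,
        trans (eval-P (suc (suc n)) (inverse Λ≉0)) (trans (K-cong Λ⁻¹≈x (suc (suc n))) Kx≈0)) ,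
      λ y (0<y , Py≈0) → ≤-resp (sym Λ⁻¹≈x) refl (≮⇒≥ λ y<x →
        <⇒≉ (K>0 y (inj₁ 0<y) y<x) (trans (sym (eval-P (suc (suc n)) y)) Py≈0)))
    where
    x = proj₁ (K-first-zero n)
    first : IsFirstZero (λ x → K x (suc (suc n))) x
    first = proj₁ (proj₂ (K-first-zero n))
    0<x = proj₁ first
    Kx≈0 = proj₁ (proj₂ first)
    K>0 = proj₂ (proj₂ first)
    x≉0 = <⇒≉ 0<x
    0≤x⁻¹ : 0# ≤ inverse x≉0
    0≤x⁻¹ = inj₁ (inverse-pos 0<x (inverse-* x≉0))
    ρ = √ 0≤x⁻¹
    ρ²x≈1 : ρ * ρ * x ≈ 1#
    ρ²x≈1 = trans (*-congʳ (√-square 0≤x⁻¹)) (inverse-* x≉0)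
    Λ≉0 : ρ * ρ ≉ 0#
    Λ≉0 Λ≈0 = <⇒≉ 0<1 (trans (sym ρ²x≈1) (trans (*-congʳ Λ≈0) (zeroˡ x)))
    -- Both sides are inverse to ρ², and inverses are unique.
    Λ⁻¹≈x : inverse Λ≉0 ≈ x
    Λ⁻¹≈x = trans (sym (*-identityʳ _)) (trans (*-congˡ (sym ρ²x≈1))
      (trans (sym (*-assoc _ _ _)) (trans (*-congʳ (inverse-* Λ≉0)) (*-identityˡ x))))
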